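{- Let $n\ge 0$ be an integer and let $x,y$ be complex numbers such that no denominator below vanishes, i.e. $x\notin\{ -1,\dots,-n\}$, $x-y\notin\{ -1,\dots,-n\}$, $1+x-y\neq0$ and $y\notin\{1,0,-1,\dots,-n\}$. Then $$\sum_{k=0}^n(-1)^k\binom{n}{k}\frac{\binom{2x-y+n+k}{k}\binom{y+k}{k}}{\binom{x+k}{k}^2}\frac{(y-1)y}{(y+k-1)(y+k)}H_{k}^{\langle2\rangle}(x)$$ $$=\frac{n^2+n(1+2x-y)+(1+x-y)^2}{(1+x-y)^2}\,\frac{\binom{x-y+n}{n}^2}{\binom{x+n}{n}^2}\Big\{H_{n}^{\langle2\rangle}(x)-H_{n}^{\langle2\rangle}(x-y)\Big\}+\frac{n^2+n(1+2x-y)}{(1+x-y)^4}\,\frac{\binom{x-y+n}{n}^2}{\binom{x+n}{n}^2}.$$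
   Context: For a complex number $u$ and an integer $k\ge 0$, $\binom{u}{k}=\frac{u(u-1)\cdots(u-k+1)}{k!}$ (equal to $1$ for $k=0$). For a complex number $u$ and a positive integer $\ell$, the generalized harmonic numbers of $\ell$-order are $H_0^{\langle\ell\rangle}(u)=0$ and $H_n^{\langle\ell\rangle}(u)=\sum_{k=1}^n\frac{1}{(u+k)^\ell}$ for $n\ge1$. -}

module Defs where

open import Algebra.Apartness.Bundles using (HeytingField; HeytingCommutativeRing)
open import Algebra.Bundles using (CommutativeRing; Semiring)
open import Data.Nat.Base as ℕ using (ℕ; zero; suc; _!)
import Data.Nat.Properties as ℕₚ
open import Data.Fin.Base as Fin using (Fin; toℕ)
import Data.Fin.Properties as Finₚ
open import Data.Product.Base using (Σ; ∃; ∃-syntax; _×_; _,_; proj₁; proj₂)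
open import Data.Sum.Base using (_⊎_; inj₁; inj₂; [_,_]′)
open import Level using (0ℓ; _⊔_)
open import Relation.Nullary using (¬_; yes; no; contradiction)

toCommutativeRing : ∀ {c ℓ₁ ℓ₂} → HeytingField c ℓ₁ ℓ₂ → CommutativeRing c ℓ₁
toCommutativeRing F = HeytingCommutativeRing.commutativeRing (HeytingField.heytingCommutativeRing F)

CharacteristicZero : ∀ {c ℓ₁ ℓ₂} → HeytingField c ℓ₁ ℓ₂ → Set ℓ₂
CharacteristicZero F = ∀ n → .{{ℕ.NonZero n}} → n · 1# # 0#
  where
  open HeytingField F using (_#_; 0#; 1#)
  open import Algebra.Definitions.RawMonoid (CommutativeRing.+-rawMonoid (toCommutativeRing F)) using () renaming (_×_ to _·_)

-- Rules out a square root of -1, in a form that lets a + bi be inverted as (a - bi) / (a² + b²)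
NormApart : ∀ {c ℓ₁ ℓ₂} → HeytingField c ℓ₁ ℓ₂ → Set (c ⊔ ℓ₂)
NormApart F = ∀ a b → a # 0# ⊎ b # 0# → a * a + b * b # 0#
  where open HeytingField F using (_#_; _+_; _*_; 0#)

module Real where

  open import Data.Rational.Base using (ℚ; 0ℚ; 1ℚ; ½; _+_; _*_; -_; _-_; ∣_∣; _≤_; _<_; 1/_; Positive; NonNegative; NonZero; positive; nonNegative; ≢-nonZero)
  open import Data.Rational.Properties hiding (#⇒invertible; invertible⇒#; isHeytingCommutativeRing; isHeytingField; heytingField)
  open import Data.Rational.Solver
  open import Relation.Binary.PropositionalEquality
  open import Algebra.Definitions using (Invertible)
  open import Algebra.Structures using (IsCommutativeRing)
  open import Relation.Binary.Definitions using (Tight; Cotransitive)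

  IsCauchy : (ℕ → ℚ) → Set
  IsCauchy f = ∀ ε → 0ℚ < ε → ∃[ N ] ∀ m n → N ℕ.≤ m → N ℕ.≤ n → ∣ f m - f n ∣ < ε

  record ℝ : Set where
    constructor mkℝ
    field
      seq    : ℕ → ℚ
      cauchy : IsCauchy seq

  open ℝ public

  infix 4 _≈ᴿ_ _#ᴿ_

  _≈ᴿ_ : ℝ → ℝ → Set
  x ≈ᴿ y = ∀ ε → 0ℚ < ε → ∃[ N ] ∀ n → N ℕ.≤ n → ∣ seq x n - seq y n ∣ < ε

  -- Eventually at distance more than some fixed δ > 0. Classically this is ¬ x ≈ᴿ y; constructively it
  -- is what division by x - y needs.
  _#ᴿ_ : ℝ → ℝ → Set
  x #ᴿ y = ∃[ δ ] 0ℚ < δ × ∃[ N ] ∀ n → N ℕ.≤ n → δ < ∣ seq x n - seq y n ∣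

  private

    half-pos : ∀ {ε} → 0ℚ < ε → 0ℚ < ½ * ε
    half-pos {ε} p = subst (_< ½ * ε) (*-zeroʳ ½) (*-monoʳ-<-pos ½ p)

    halves : ∀ ε → ½ * ε + ½ * ε ≡ ε
    halves ε = trans (sym (*-distribʳ-+ ε ½ ½)) (*-identityˡ ε)

    opaque
      scale : ∀ {B ε} → 0ℚ < B → 0ℚ < ε → ∃[ δ ] 0ℚ < δ × B * δ ≡ ε
      scale {B} {ε} 0<B 0<ε = 1/ B * ε , pos , eq
        where
        instance
          B⁺ : Positive B
          B⁺ = positive 0<B
          B≢0 : NonZero B
          B≢0 = pos⇒nonZero B
          1/B⁺ : Positive (1/ B)
          1/B⁺ = 1/pos⇒pos B
        pos : 0ℚ < 1/ B * ε
        pos = subst (_< 1/ B * ε) (*-zeroʳ (1/ B)) (*-monoʳ-<-pos (1/ B) 0<ε)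
        eq : B * (1/ B * ε) ≡ ε
        eq = trans (sym (*-assoc B (1/ B) ε)) (trans (cong (_* ε) (*-inverseʳ B)) (*-identityˡ ε))

    dist-sym : ∀ a b → ∣ a - b ∣ ≡ ∣ b - a ∣
    dist-sym a b = trans (sym (∣-p∣≡∣p∣ (a - b))) (cong ∣_∣ (solve 2 (λ a b → :- (a :- b) := b :- a) refl a b))
      where open +-*-Solver

    tri : ∀ a b c → ∣ a - c ∣ ≤ ∣ a - b ∣ + ∣ b - c ∣
    tri a b c = subst (λ z → ∣ z ∣ ≤ ∣ a - b ∣ + ∣ b - c ∣)
      (solve 3 (λ a b c → (a :- b) :+ (b :- c) := a :- c) refl a b c)
      (∣p+q∣≤∣p∣+∣q∣ (a - b) (b - c))
      where open +-*-Solver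

    split : ∀ p q → ∣ p ∣ ≤ ∣ q ∣ + ∣ p - q ∣
    split p q = subst (λ z → ∣ z ∣ ≤ ∣ q ∣ + ∣ p - q ∣)
      (solve 2 (λ p q → q :+ (p :- q) := p) refl p q) (∣p+q∣≤∣p∣+∣q∣ q (p - q))
      where open +-*-Solver

    +-close : ∀ {ε} a b c d → ∣ a - c ∣ < ½ * ε → ∣ b - d ∣ < ½ * ε → ∣ (a + b) - (c + d) ∣ < ε
    +-close {ε} a b c d p q = subst₂ _<_ refl (halves ε) (≤-<-trans le (+-mono-< p q))
      where
      open +-*-Solver
      le : ∣ (a + b) - (c + d) ∣ ≤ ∣ a - c ∣ + ∣ b - d ∣
      le = subst (λ z → ∣ z ∣ ≤ ∣ a - c ∣ + ∣ b - d ∣)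
        (solve 4 (λ a b c d → (a :- c) :+ (b :- d) := (a :+ b) :- (c :+ d)) refl a b c d)
        (∣p+q∣≤∣p∣+∣q∣ (a - c) (b - d))

    ∣*∣-< : ∀ {B δ} p q → 0ℚ < δ → ∣ p ∣ < B → ∣ q ∣ < δ → ∣ p * q ∣ < B * δ
    ∣*∣-< {B} {δ} p q 0<δ p<B q<δ = begin-strict
      ∣ p * q ∣     ≡⟨ ∣p*q∣≡∣p∣*∣q∣ p q ⟩
      ∣ p ∣ * ∣ q ∣ ≤⟨ *-monoˡ-≤-nonNeg ∣ p ∣ (<⇒≤ q<δ) ⟩
      ∣ p ∣ * δ     <⟨ *-monoˡ-<-pos δ p<B ⟩
      B * δ         ∎
      where
      open ≤-Reasoning
      instance _ = positive 0<δ
               _ = ∣-∣-nonNeg p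

    *-close : ∀ {ε B δ} a b c d → 0ℚ < δ → B * δ ≡ ½ * ε →
              ∣ b ∣ < B → ∣ c ∣ < B → ∣ a - c ∣ < δ → ∣ b - d ∣ < δ →
              ∣ a * b - c * d ∣ < ε
    *-close {ε} {B} {δ} a b c d 0<δ eq b<B c<B p q = begin-strict
      ∣ a * b - c * d ∣                     ≡⟨ cong ∣_∣ (solve 4 (λ a b c d → a :* b :- c :* d := b :* (a :- c) :+ c :* (b :- d)) refl a b c d) ⟩
      ∣ b * (a - c) + c * (b - d) ∣         ≤⟨ ∣p+q∣≤∣p∣+∣q∣ (b * (a - c)) (c * (b - d)) ⟩
      ∣ b * (a - c) ∣ + ∣ c * (b - d) ∣     <⟨ +-mono-< (∣*∣-< b (a - c) 0<δ b<B p) (∣*∣-< c (b - d) 0<δ c<B q) ⟩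
      B * δ + B * δ                         ≡⟨ cong₂ _+_ eq eq ⟩
      ½ * ε + ½ * ε                         ≡⟨ halves ε ⟩
      ε                                     ∎
      where
      open ≤-Reasoning
      open +-*-Solver

    lub₂ : ∀ {m n k} → m ℕ.⊔ n ℕ.≤ k → m ℕ.≤ k × n ℕ.≤ k
    lub₂ {m} {n} le = ℕₚ.≤-trans (ℕₚ.m≤m⊔n m n) le , ℕₚ.≤-trans (ℕₚ.m≤n⊔m m n) le

    p≤q+p : ∀ q p → 0ℚ ≤ q → p ≤ q + p
    p≤q+p q p 0≤q = subst (_≤ q + p) (+-identityˡ p) (+-monoˡ-≤ p 0≤q)

    opaque
      bounded : (x : ℝ) → ∃[ B ] 0ℚ < B × ∃[ N ] ∀ n → N ℕ.≤ n → ∣ seq x n ∣ < B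
      bounded x with cauchy x 1ℚ (positive⁻¹ 1ℚ)
      ... | N , h = ∣ seq x N ∣ + 1ℚ
                  , <-≤-trans (positive⁻¹ 1ℚ) (p≤q+p ∣ seq x N ∣ 1ℚ (0≤∣p∣ (seq x N)))
                  , N
                  , λ n N≤n → ≤-<-trans (split (seq x n) (seq x N)) (+-monoʳ-< ∣ seq x N ∣ (h n N N≤n ℕₚ.≤-refl))

    opaque
      bounded₂ : (x y : ℝ) → ∃[ B ] 0ℚ < B × ∃[ N ] ∀ n → N ℕ.≤ n → ∣ seq x n ∣ < B × ∣ seq y n ∣ < B
      bounded₂ x y with bounded x | bounded y
      ... | A , 0<A , M , f | B , 0<B , N , g =
        A + B , <-trans 0<A A<A+B , M ℕ.⊔ N , λ n le →
          <-trans (f n (proj₁ (lub₂ {M} {N} le))) A<A+B , <-trans (g n (proj₂ (lub₂ {M} {N} le))) B<A+B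
        where
        A<A+B : A < A + B
        A<A+B = subst (_< A + B) (+-identityʳ A) (+-monoʳ-< A 0<B)
        B<A+B : B < A + B
        B<A+B = subst (_< A + B) (+-identityˡ B) (+-monoˡ-< B 0<A)

    opaque
      const-cauchy : ∀ q → IsCauchy (λ _ → q)
      const-cauchy q ε 0<ε = 0 , λ _ _ _ _ → subst (_< ε) (sym (cong ∣_∣ (+-inverseʳ q))) 0<ε

    opaque
      +-cauchy : ∀ x y → IsCauchy (λ n → seq x n + seq y n)
      +-cauchy x y ε 0<ε with cauchy x (½ * ε) (half-pos 0<ε) | cauchy y (½ * ε) (half-pos 0<ε)
      ... | M , f | N , g = M ℕ.⊔ N , λ m n p q →
        +-close (seq x m) (seq y m) (seq x n) (seq y n)
          (f m n (proj₁ (lub₂ p)) (proj₁ (lub₂ q))) (g m n (proj₂ (lub₂ {M} p)) (proj₂ (lub₂ {M} q)))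

    neg-close : ∀ {ε} a b → ∣ a - b ∣ < ε → ∣ - a - - b ∣ < ε
    neg-close {ε} a b = subst (_< ε) (trans (dist-sym a b) (cong ∣_∣ (solve 2 (λ a b → b :- a := :- a :- :- b) refl a b)))
      where open +-*-Solver

    opaque
      neg-cauchy : ∀ x → IsCauchy (λ n → - seq x n)
      neg-cauchy x ε 0<ε with cauchy x ε 0<ε
      ... | N , f = N , λ m n p q → neg-close (seq x m) (seq x n) (f m n p q)

    opaque
      *-cauchy : ∀ x y → IsCauchy (λ n → seq x n * seq y n)
      *-cauchy x y ε 0<ε with bounded₂ x y
      ... | B , 0<B , K , h with scale 0<B (half-pos 0<ε)
      ... | δ , 0<δ , eq with cauchy x δ 0<δ | cauchy y δ 0<δ
      ... | M , f | N , g = K ℕ.⊔ (M ℕ.⊔ N) , λ m n p q →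
        let p₁ , p₂ = lub₂ {K} p ; q₁ , q₂ = lub₂ {K} q in
        *-close (seq x m) (seq y m) (seq x n) (seq y n) 0<δ eq (proj₂ (h m p₁)) (proj₁ (h n q₁))
          (f m n (proj₁ (lub₂ p₂)) (proj₁ (lub₂ q₂))) (g m n (proj₂ (lub₂ {M} p₂)) (proj₂ (lub₂ {M} q₂)))

  infixl 6 _+ᴿ_ _-ᴿ_
  infixl 7 _*ᴿ_
  infix  8 -ᴿ_

  fromℚ : ℚ → ℝ
  fromℚ q = mkℝ (λ _ → q) (const-cauchy q)

  0ᴿ 1ᴿ : ℝ
  0ᴿ = fromℚ 0ℚ
  1ᴿ = fromℚ 1ℚ

  _+ᴿ_ : ℝ → ℝ → ℝ
  x +ᴿ y = mkℝ (λ n → seq x n + seq y n) (+-cauchy x y)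

  -ᴿ_ : ℝ → ℝ
  -ᴿ x = mkℝ (λ n → - seq x n) (neg-cauchy x)

  _-ᴿ_ : ℝ → ℝ → ℝ
  x -ᴿ y = x +ᴿ -ᴿ y

  _*ᴿ_ : ℝ → ℝ → ℝ
  x *ᴿ y = mkℝ (λ n → seq x n * seq y n) (*-cauchy x y)

  private
    eventually≡⇒≈ : ∀ x y → (∃[ N ] ∀ n → N ℕ.≤ n → seq x n ≡ seq y n) → x ≈ᴿ y
    eventually≡⇒≈ x y (N , h) ε 0<ε = N , λ n le →
      subst (_< ε) (sym (cong ∣_∣ (trans (cong (_- seq y n) (h n le)) (+-inverseʳ (seq y n))))) 0<ε

    pointwise : ∀ x y → (∀ n → seq x n ≡ seq y n) → x ≈ᴿ y
    pointwise x y h = eventually≡⇒≈ x y (0 , λ n _ → h n)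

    ≈-refl : ∀ {x} → x ≈ᴿ x
    ≈-refl {x} = pointwise x x (λ _ → refl)

    ≈-sym : ∀ {x y} → x ≈ᴿ y → y ≈ᴿ x
    ≈-sym {x} {y} p ε 0<ε with p ε 0<ε
    ... | N , h = N , λ n le → subst (_< ε) (dist-sym (seq x n) (seq y n)) (h n le)

    ≈-trans : ∀ {x y z} → x ≈ᴿ y → y ≈ᴿ z → x ≈ᴿ z
    ≈-trans {x} {y} {z} p q ε 0<ε with p (½ * ε) (half-pos 0<ε) | q (½ * ε) (half-pos 0<ε)
    ... | M , f | N , g = M ℕ.⊔ N , λ n le →
      ≤-<-trans (tri (seq x n) (seq y n) (seq z n))
        (subst (∣ seq x n - seq y n ∣ + ∣ seq y n - seq z n ∣ <_) (halves ε)
          (+-mono-< (f n (proj₁ (lub₂ le))) (g n (proj₂ (lub₂ {M} le)))))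

    +-congᴿ : ∀ {x y u v} → x ≈ᴿ y → u ≈ᴿ v → x +ᴿ u ≈ᴿ y +ᴿ v
    +-congᴿ {x} {y} {u} {v} p q ε 0<ε with p (½ * ε) (half-pos 0<ε) | q (½ * ε) (half-pos 0<ε)
    ... | M , f | N , g = M ℕ.⊔ N , λ n le →
      +-close (seq x n) (seq u n) (seq y n) (seq v n) (f n (proj₁ (lub₂ le))) (g n (proj₂ (lub₂ {M} le)))

    neg-congᴿ : ∀ {x y} → x ≈ᴿ y → -ᴿ x ≈ᴿ -ᴿ y
    neg-congᴿ {x} {y} p ε 0<ε with p ε 0<ε
    ... | N , h = N , λ n le → neg-close (seq x n) (seq y n) (h n le)

    *-congᴿ : ∀ {x y u v} → x ≈ᴿ y → u ≈ᴿ v → x *ᴿ u ≈ᴿ y *ᴿ v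
    *-congᴿ {x} {y} {u} {v} p q ε 0<ε with bounded₂ u y
    ... | B , 0<B , K , h with scale 0<B (half-pos 0<ε)
    ... | δ , 0<δ , eq with p δ 0<δ | q δ 0<δ
    ... | M , f | N , g = K ℕ.⊔ (M ℕ.⊔ N) , λ n le →
      let l₁ , l₂ = lub₂ {K} le in
      *-close (seq x n) (seq u n) (seq y n) (seq v n) 0<δ eq (proj₁ (h n l₁)) (proj₂ (h n l₁))
        (f n (proj₁ (lub₂ l₂))) (g n (proj₂ (lub₂ {M} l₂)))

  isCommutativeRing : IsCommutativeRing _≈ᴿ_ _+ᴿ_ _*ᴿ_ -ᴿ_ 0ᴿ 1ᴿ
  isCommutativeRing = record
    { isRing = record
      { +-isAbelianGroup = record
        { isGroup = record
          { isMonoid = record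
            { isSemigroup = record
              { isMagma = record
                { isEquivalence = record
                  { refl  = λ {x} → ≈-refl {x}
                  ; sym   = λ {x} {y} → ≈-sym {x} {y}
                  ; trans = λ {x} {y} {z} → ≈-trans {x} {y} {z}
                  }
                ; ∙-cong = λ {x} {y} {u} {v} → +-congᴿ {x} {y} {u} {v}
                }
              ; assoc = λ x y z → pointwise ((x +ᴿ y) +ᴿ z) (x +ᴿ (y +ᴿ z)) λ n → +-assoc (seq x n) (seq y n) (seq z n)
              }
            ; identity = (λ x → pointwise (0ᴿ +ᴿ x) x λ n → +-identityˡ (seq x n))
                       , (λ x → pointwise (x +ᴿ 0ᴿ) x λ n → +-identityʳ (seq x n))
            }
          ; inverse = (λ x → pointwise (-ᴿ x +ᴿ x) 0ᴿ λ n → +-inverseˡ (seq x n))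
                    , (λ x → pointwise (x +ᴿ -ᴿ x) 0ᴿ λ n → +-inverseʳ (seq x n))
          ; ⁻¹-cong = λ {x} {y} → neg-congᴿ {x} {y}
          }
        ; comm = λ x y → pointwise (x +ᴿ y) (y +ᴿ x) λ n → +-comm (seq x n) (seq y n)
        }
      ; *-cong = λ {x} {y} {u} {v} → *-congᴿ {x} {y} {u} {v}
      ; *-assoc = λ x y z → pointwise ((x *ᴿ y) *ᴿ z) (x *ᴿ (y *ᴿ z)) λ n → *-assoc (seq x n) (seq y n) (seq z n)
      ; *-identity = (λ x → pointwise (1ᴿ *ᴿ x) x λ n → *-identityˡ (seq x n))
                   , (λ x → pointwise (x *ᴿ 1ᴿ) x λ n → *-identityʳ (seq x n))
      ; distrib = (λ x y z → pointwise (x *ᴿ (y +ᴿ z)) (x *ᴿ y +ᴿ x *ᴿ z) λ n → *-distribˡ-+ (seq x n) (seq y n) (seq z n))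
                , (λ x y z → pointwise ((y +ᴿ z) *ᴿ x) (y *ᴿ x +ᴿ z *ᴿ x) λ n → *-distribʳ-+ (seq x n) (seq y n) (seq z n))
      }
    ; *-comm = λ x y → pointwise (x *ᴿ y) (y *ᴿ x) λ n → *-comm (seq x n) (seq y n)
    }

  commutativeRing : CommutativeRing 0ℓ 0ℓ
  commutativeRing = record { isCommutativeRing = isCommutativeRing }

  private
    #-irrefl : ∀ {x y} → x ≈ᴿ y → ¬ x #ᴿ y
    #-irrefl p (δ , 0<δ , N , h) with p δ 0<δ
    ... | M , f = <-asym (h (M ℕ.⊔ N) (ℕₚ.m≤n⊔m M N)) (f (M ℕ.⊔ N) (ℕₚ.m≤m⊔n M N))

    #-sym : ∀ {x y} → x #ᴿ y → y #ᴿ x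
    #-sym {x} {y} (δ , 0<δ , N , h) = δ , 0<δ , N , λ n le → subst (δ <_) (dist-sym (seq x n) (seq y n)) (h n le)

    -- A value of size more than δ at a stage beyond which the sequence varies by less than ½ δ
    persist : ∀ x y {δ} → 0ℚ < δ → ∀ N →
              (∀ m n → N ℕ.≤ m → N ℕ.≤ n → ∣ seq (x -ᴿ y) m - seq (x -ᴿ y) n ∣ < ½ * δ) →
              δ < ∣ seq x N - seq y N ∣ → x #ᴿ y
    persist x y {δ} 0<δ N h big = ½ * δ , half-pos 0<δ , N , λ n le → ≰⇒> λ small →
      <-irrefl refl (<-trans big (≤-<-trans (split (d N) (d n))
        (subst (∣ d n ∣ + ∣ d N - d n ∣ <_) (halves δ) (+-mono-≤-< small (h N n ℕₚ.≤-refl le)))))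
      where
      d : ℕ → ℚ
      d = seq (x -ᴿ y)

    #-cotrans : Cotransitive _#ᴿ_
    #-cotrans {x} {y} (δ , 0<δ , N , h) z
      with cauchy (x -ᴿ z) (½ * (½ * δ)) (half-pos (half-pos 0<δ)) | cauchy (z -ᴿ y) (½ * (½ * δ)) (half-pos (half-pos 0<δ))
    ... | A , f | B , g with ½ * δ <? ∣ seq x (N ℕ.⊔ (A ℕ.⊔ B)) - seq z (N ℕ.⊔ (A ℕ.⊔ B)) ∣
    ... | yes p = inj₁ (persist x z (half-pos 0<δ) K
                    (λ m n p q → f m n (ℕₚ.≤-trans A≤K p) (ℕₚ.≤-trans A≤K q)) p)
      where
      K = N ℕ.⊔ (A ℕ.⊔ B)
      A≤K = proj₁ (lub₂ {A} {B} (proj₂ (lub₂ {N} {A ℕ.⊔ B} {K} ℕₚ.≤-refl)))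
    ... | no ¬p = inj₂ (persist z y (half-pos 0<δ) K
                    (λ m n p q → g m n (ℕₚ.≤-trans B≤K p) (ℕₚ.≤-trans B≤K q))
                    (≰⇒> λ small → <-irrefl refl (<-≤-trans (h K N≤K) (≤-trans (tri (seq x K) (seq z K) (seq y K))
                      (subst (∣ seq x K - seq z K ∣ + ∣ seq z K - seq y K ∣ ≤_) (halves δ) (+-mono-≤ (≮⇒≥ ¬p) small))))))
      where
      K = N ℕ.⊔ (A ℕ.⊔ B)
      N≤K = proj₁ (lub₂ {N} {A ℕ.⊔ B} {K} ℕₚ.≤-refl)
      B≤K = proj₂ (lub₂ {A} {B} (proj₂ (lub₂ {N} {A ℕ.⊔ B} {K} ℕₚ.≤-refl)))

    ¬#⇒≈ : ∀ x y → ¬ x #ᴿ y → x ≈ᴿ y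
    ¬#⇒≈ x y ¬x#y ε 0<ε with cauchy (x -ᴿ y) (½ * (½ * ε)) (half-pos (half-pos 0<ε))
    ... | N , f with ½ * ε <? ∣ seq x N - seq y N ∣
    ... | yes p = contradiction (persist x y (half-pos 0<ε) N f p) ¬x#y
    ... | no ¬p = N , λ n le → subst (∣ d n ∣ <_) (halves ε)
      (≤-<-trans (split (d n) (d N)) (+-mono-≤-< (≮⇒≥ ¬p) (<-trans (f n N le ℕₚ.≤-refl) shrink)))
      where
      d : ℕ → ℚ
      d = seq (x -ᴿ y)
      shrink : ½ * (½ * ε) < ½ * ε
      shrink = subst₂ _<_ (+-identityˡ (½ * (½ * ε))) (halves (½ * ε)) (+-monoˡ-< (½ * (½ * ε)) (half-pos (half-pos 0<ε)))

    opaque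
      inv : ℚ → ℚ
      inv q with q ≟ 0ℚ
      ... | yes _   = 0ℚ
      ... | no  q≢0 = (1/ q) {{≢-nonZero q≢0}}

      inv-cancel : ∀ q → q ≢ 0ℚ → inv q * q ≡ 1ℚ
      inv-cancel q q≢0 with q ≟ 0ℚ
      ... | yes q≡0 = contradiction q≡0 q≢0
      ... | no  q≢0 = *-inverseˡ q {{≢-nonZero q≢0}}

    apart⇒≢ : ∀ {δ q} → 0ℚ < δ → δ < ∣ q ∣ → q ≢ 0ℚ
    apart⇒≢ 0<δ δ<q refl = <-asym 0<δ δ<q

    inv-bound : ∀ {δ c} q → 0ℚ < δ → δ * c ≡ 1ℚ → δ < ∣ q ∣ → ∣ inv q ∣ ≤ c
    inv-bound {δ} {c} q 0<δ eq δ<q = *-cancelʳ-≤-pos δ (begin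
      ∣ inv q ∣ * δ     ≤⟨ *-monoˡ-≤-nonNeg ∣ inv q ∣ (<⇒≤ δ<q) ⟩
      ∣ inv q ∣ * ∣ q ∣ ≡⟨ ∣p*q∣≡∣p∣*∣q∣ (inv q) q ⟨
      ∣ inv q * q ∣     ≡⟨ cong ∣_∣ (inv-cancel q (apart⇒≢ 0<δ δ<q)) ⟩
      1ℚ                ≡⟨ eq ⟨
      δ * c             ≡⟨ *-comm δ c ⟩
      c * δ             ∎)
      where
      open ≤-Reasoning
      instance _ = positive 0<δ
               _ = ∣-∣-nonNeg (inv q)

    opaque
      inv-cauchy : ∀ x y → x #ᴿ y → IsCauchy (λ n → inv (seq x n - seq y n))
      inv-cauchy x y (δ , 0<δ , N , h) ε 0<ε with scale 0<δ (positive⁻¹ 1ℚ)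
      ... | c , 0<c , δc≡1 with scale 0<c 0<ε
      ... | η , 0<η , cη≡ε with scale 0<c 0<η
      ... | θ , 0<θ , cθ≡η with cauchy (x -ᴿ y) θ 0<θ
      ... | M , f = N ℕ.⊔ M , λ m n p q → close m n (h m (proj₁ (lub₂ p))) (h n (proj₁ (lub₂ q)))
                      (f n m (proj₂ (lub₂ {N} q)) (proj₂ (lub₂ {N} p)))
        where
        d : ℕ → ℚ
        d = seq (x -ᴿ y)
        open +-*-Solver
        close : ∀ m n → δ < ∣ d m ∣ → δ < ∣ d n ∣ → ∣ d n - d m ∣ < θ → ∣ inv (d m) - inv (d n) ∣ < ε
        close m n p q r = begin-strict
          ∣ a′ - b′ ∣                       ≡⟨ cong ∣_∣ alg ⟩
          ∣ a′ * (b′ * (b - a)) ∣           ≡⟨ ∣p*q∣≡∣p∣*∣q∣ a′ (b′ * (b - a)) ⟩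
          ∣ a′ ∣ * ∣ b′ * (b - a) ∣         ≤⟨ *-monoʳ-≤-nonNeg ∣ b′ * (b - a) ∣ (inv-bound a 0<δ δc≡1 p) ⟩
          c * ∣ b′ * (b - a) ∣              ≡⟨ cong (c *_) (∣p*q∣≡∣p∣*∣q∣ b′ (b - a)) ⟩
          c * (∣ b′ ∣ * ∣ b - a ∣)          ≤⟨ *-monoˡ-≤-nonNeg c (*-monoʳ-≤-nonNeg ∣ b - a ∣ (inv-bound b 0<δ δc≡1 q)) ⟩
          c * (c * ∣ b - a ∣)               <⟨ *-monoʳ-<-pos c (*-monoʳ-<-pos c r) ⟩
          c * (c * θ)                       ≡⟨ cong (c *_) cθ≡η ⟩
          c * η                             ≡⟨ cη≡ε ⟩
          ε                                 ∎
          where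
          open ≤-Reasoning
          a b a′ b′ : ℚ
          a = d m
          b = d n
          a′ = inv a
          b′ = inv b
          instance
            c⁺ : Positive c
            c⁺ = positive 0<c
            c≥0 : NonNegative c
            c≥0 = nonNegative (<⇒≤ 0<c)
            ∣b′[b-a]∣≥0 : NonNegative ∣ b′ * (b - a) ∣
            ∣b′[b-a]∣≥0 = ∣-∣-nonNeg (b′ * (b - a))
            ∣b-a∣≥0 : NonNegative ∣ b - a ∣
            ∣b-a∣≥0 = ∣-∣-nonNeg (b - a)
          alg : a′ - b′ ≡ a′ * (b′ * (b - a))
          alg = sym (trans
            (solve 4 (λ a b s t → s :* (t :* (b :- a)) := s :* (t :* b) :- t :* (s :* a)) refl a b a′ b′)
            (trans (cong₂ (λ u v → a′ * u - b′ * v) (inv-cancel b (apart⇒≢ 0<δ q)) (inv-cancel a (apart⇒≢ 0<δ p)))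
                   (cong₂ _-_ (*-identityʳ a′) (*-identityʳ b′))))

    #⇒invertible : ∀ {x y} → x #ᴿ y → Invertible _≈ᴿ_ 1ᴿ _*ᴿ_ (x -ᴿ y)
    #⇒invertible {x} {y} x#y@(δ , 0<δ , N , h) = w
      , eventually≡⇒≈ (w *ᴿ (x -ᴿ y)) 1ᴿ (N , eq)
      , eventually≡⇒≈ ((x -ᴿ y) *ᴿ w) 1ᴿ (N , λ n le → trans (*-comm (seq x n - seq y n) (seq w n)) (eq n le))
      where
      w : ℝ
      w = mkℝ (λ n → inv (seq x n - seq y n)) (inv-cauchy x y x#y)
      eq : ∀ n → N ℕ.≤ n → inv (seq x n - seq y n) * (seq x n - seq y n) ≡ 1ℚ
      eq n le = inv-cancel (seq x n - seq y n) (apart⇒≢ 0<δ (h n le))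

    invertible⇒# : ∀ {x y} → Invertible _≈ᴿ_ 1ᴿ _*ᴿ_ (x -ᴿ y) → x #ᴿ y
    invertible⇒# {x} {y} (w , wd≈1 , _) with bounded w | wd≈1 ½ (positive⁻¹ ½)
    ... | B , 0<B , M , f | N , g with scale 0<B (positive⁻¹ ½)
    ... | δ , 0<δ , Bδ≡½ = δ , 0<δ , M ℕ.⊔ N , λ n le →
      large (seq w n) (seq x n - seq y n) (f n (proj₁ (lub₂ le))) (g n (proj₂ (lub₂ {M} le)))
      where
      large : ∀ u d → ∣ u ∣ < B → ∣ u * d - 1ℚ ∣ < ½ → δ < ∣ d ∣
      large u d u<B p = ≰⇒> λ small → <-irrefl refl (begin-strict
        1ℚ                          ≤⟨ split 1ℚ (u * d) ⟩
        ∣ u * d ∣ + ∣ 1ℚ - u * d ∣  ≡⟨ cong₂ _+_ (∣p*q∣≡∣p∣*∣q∣ u d) (dist-sym 1ℚ (u * d)) ⟩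
        ∣ u ∣ * ∣ d ∣ + ∣ u * d - 1ℚ ∣ <⟨ +-monoʳ-< (∣ u ∣ * ∣ d ∣) p ⟩
        ∣ u ∣ * ∣ d ∣ + ½           ≤⟨ +-monoˡ-≤ ½ (*-monoˡ-≤-nonNeg ∣ u ∣ small) ⟩
        ∣ u ∣ * δ + ½               ≤⟨ +-monoˡ-≤ ½ (*-monoʳ-≤-nonNeg δ (<⇒≤ u<B)) ⟩
        B * δ + ½                   ≡⟨ cong (_+ ½) Bδ≡½ ⟩
        1ℚ                          ∎)
        where
        open ≤-Reasoning
        instance _ = ∣-∣-nonNeg u
                 _ = nonNegative (<⇒≤ 0<δ)

  ℝ-heytingField : HeytingField 0ℓ 0ℓ 0ℓ
  ℝ-heytingField = record
    { isHeytingField = record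
      { isHeytingCommutativeRing = record
        { isCommutativeRing = isCommutativeRing
        ; isApartnessRelation = record
          { irrefl  = λ {x} {y} → #-irrefl {x} {y}
          ; sym     = λ {x} {y} → #-sym {x} {y}
          ; cotrans = λ {x} {y} → #-cotrans {x} {y}
          }
        ; #⇒invertible = λ {x} {y} → #⇒invertible {x} {y}
        ; invertible⇒# = λ {x} {y} → invertible⇒# {x} {y}
        }
      ; tight = λ x y → ¬#⇒≈ x y , #-irrefl {x} {y}
      }
    }

  private

    ∣q∣∣q∣≡qq : ∀ q → ∣ q ∣ * ∣ q ∣ ≡ q * q
    ∣q∣∣q∣≡qq q with ∣p∣≡p∨∣p∣≡-p q
    ... | inj₁ eq = cong₂ _*_ eq eq
    ... | inj₂ eq = trans (cong₂ _*_ eq eq) (solve 1 (λ q → :- q :* :- q := q :* q) refl q)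
      where open +-*-Solver

    0≤qq : ∀ q → 0ℚ ≤ q * q
    0≤qq q = subst₂ _≤_ (*-zeroʳ ∣ q ∣) (∣q∣∣q∣≡qq q) (*-monoˡ-≤-nonNeg ∣ q ∣ {{∣-∣-nonNeg q}} (0≤∣p∣ q))

    q-0 : ∀ q → q - 0ℚ ≡ q
    q-0 q = +-identityʳ q

    δδ<qq : ∀ {δ} q → 0ℚ < δ → δ < ∣ q - 0ℚ ∣ → δ * δ < q * q
    δδ<qq {δ} q 0<δ δ<q = <-trans (*-monoʳ-<-pos δ {{positive 0<δ}} δ<∣q∣)
      (subst (δ * ∣ q ∣ <_) (∣q∣∣q∣≡qq q) (*-monoˡ-<-pos ∣ q ∣ {{positive (<-trans 0<δ δ<∣q∣)}} δ<∣q∣))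
      where
      δ<∣q∣ : δ < ∣ q ∣
      δ<∣q∣ = subst (λ z → δ < ∣ z ∣) (q-0 q) δ<q

    δ<∣p-0∣ : ∀ {δ} p → 0ℚ < δ → δ < p → δ < ∣ p - 0ℚ ∣
    δ<∣p-0∣ {δ} p 0<δ δ<p = subst (δ <_) (sym (trans (cong ∣_∣ (q-0 p)) (0≤p⇒∣p∣≡p (<⇒≤ (<-trans 0<δ δ<p))))) δ<p

    0<δδ : ∀ {δ} → 0ℚ < δ → 0ℚ < δ * δ
    0<δδ {δ} 0<δ = subst (_< δ * δ) (*-zeroʳ δ) (*-monoʳ-<-pos δ {{positive 0<δ}} 0<δ)

  opaque
    norm#0 : NormApart ℝ-heytingField
    norm#0 x y (inj₁ (δ , 0<δ , N , h)) = δ * δ , 0<δδ 0<δ , N , λ n le →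
      let a = seq x n ; b = seq y n in
      δ<∣p-0∣ (a * a + b * b) (0<δδ 0<δ) (subst (_< a * a + b * b) (+-identityʳ (δ * δ))
        (+-mono-<-≤ (δδ<qq a 0<δ (h n le)) (0≤qq b)))
    norm#0 x y (inj₂ (δ , 0<δ , N , h)) = δ * δ , 0<δδ 0<δ , N , λ n le →
      let a = seq x n ; b = seq y n in
      δ<∣p-0∣ (a * a + b * b) (0<δδ 0<δ) (subst (_< a * a + b * b) (+-identityˡ (δ * δ))
        (+-mono-≤-< (0≤qq a) (δδ<qq b 0<δ (h n le))))

  open import Algebra.Definitions.RawMonoid (CommutativeRing.+-rawMonoid commutativeRing) using () renaming (_×_ to _·_)

  private

    seq-· : ∀ m n → 1ℚ ≤ seq (suc m · 1ᴿ) n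
    seq-· zero    n = ≤-reflexive (sym (+-identityʳ 1ℚ))
    seq-· (suc m) n = ≤-trans (seq-· m n) (p≤q+p 1ℚ (seq (suc m · 1ᴿ) n) (<⇒≤ (positive⁻¹ 1ℚ)))

  opaque
    characteristicZero : CharacteristicZero ℝ-heytingField
    characteristicZero (suc m) = ½ , positive⁻¹ ½ , 0 , λ n _ →
      δ<∣p-0∣ (seq (suc m · 1ᴿ) n) (positive⁻¹ ½) (<-≤-trans ½<1 (seq-· m n))
      where
      ½<1 : ½ < 1ℚ
      ½<1 = subst (_< 1ℚ) (+-identityʳ ½) (+-monoʳ-< ½ (positive⁻¹ ½))

module Complexification {c ℓ₁ ℓ₂} (R : HeytingField c ℓ₁ ℓ₂) (norm#0 : NormApart R) where

  open HeytingField R using (Carrier; _#_; _+_; _*_; 0#; _≈_; -_; _-_; 1#; +-cong; +-congˡ; +-congʳ; +-assoc; +-comm; +-identityˡ; +-identityʳ; -‿inverseˡ; -‿inverseʳ; -‿cong; *-cong; *-congˡ; *-congʳ; *-assoc; *-comm; *-identityˡ; *-identityʳ; zeroˡ; zeroʳ; refl; sym; trans; #-sym; #-irrefl; #-cotrans; #⇒invertible; invertible⇒#; tight; heytingCommutativeRing)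
  open import Algebra.Definitions using (Invertible)
  open import Algebra.Structures using (IsCommutativeRing)
  open import Algebra.Apartness.Properties.HeytingCommutativeRing heytingCommutativeRing using (x-0≈x; 1#0; #-congʳ)
  open import Relation.Binary.Definitions using (Cotransitive)

  open CommutativeRing (toCommutativeRing R) using (ring; commutativeSemiring)
  open import Algebra.Properties.Ring ring using (-1*x≈-x; -‿distribˡ-*; -‿involutive)
  open import Algebra.Solver.Ring.NaturalCoefficients.Default commutativeSemiring

  record ℂ : Set c where
    constructor _+i_
    field
      re im : Carrier

  open ℂ

  infix  4 _≈ᶜ_ _#ᶜ_
  infixl 6 _+ᶜ_ _-ᶜ_
  infixl 7 _*ᶜ_
  infix  8 -ᶜ_

  _≈ᶜ_ : ℂ → ℂ → Set ℓ₁
  z ≈ᶜ w = re z ≈ re w × im z ≈ im w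

  _#ᶜ_ : ℂ → ℂ → Set ℓ₂
  z #ᶜ w = re z # re w ⊎ im z # im w

  0ᶜ 1ᶜ : ℂ
  0ᶜ = 0# +i 0#
  1ᶜ = 1# +i 0#

  _+ᶜ_ _*ᶜ_ : ℂ → ℂ → ℂ
  (a +i b) +ᶜ (c +i d) = (a + c) +i (b + d)
  (a +i b) *ᶜ (c +i d) = (a * c - b * d) +i (a * d + b * c)

  -ᶜ_ : ℂ → ℂ
  -ᶜ (a +i b) = (- a) +i (- b)

  _-ᶜ_ : ℂ → ℂ → ℂ
  z -ᶜ w = z +ᶜ -ᶜ w

  private

    -- Multiplication with -1 as a coefficient, so that its laws are semiring identities
    infixl 7 _⊗_
    _⊗_ : ℂ → ℂ → ℂ
    (a +i b) ⊗ (c +i d) = (a * c + - 1# * (b * d)) +i (a * d + b * c)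

    *≈⊗ : ∀ z w → z *ᶜ w ≈ᶜ z ⊗ w
    *≈⊗ (a +i b) (c +i d) = +-congˡ (sym (-1*x≈-x (b * d))) , refl

    ⊗-cong : ∀ {z z′ w w′} → z ≈ᶜ z′ → w ≈ᶜ w′ → z ⊗ w ≈ᶜ z′ ⊗ w′
    ⊗-cong (p , q) (r , s) = +-cong (*-cong p r) (*-congˡ (*-cong q s)) , +-cong (*-cong p s) (*-cong q r)

    ⊗-assoc : ∀ z w v → (z ⊗ w) ⊗ v ≈ᶜ z ⊗ (w ⊗ v)
    ⊗-assoc (a +i b) (c +i d) (e +i f) =
      solve 7 (λ m a b c d e f → (a :* c :+ m :* (b :* d)) :* e :+ m :* ((a :* d :+ b :* c) :* f)
                              := a :* (c :* e :+ m :* (d :* f)) :+ m :* (b :* (c :* f :+ d :* e)))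
        refl (- 1#) a b c d e f ,
      solve 7 (λ m a b c d e f → (a :* c :+ m :* (b :* d)) :* f :+ (a :* d :+ b :* c) :* e
                              := a :* (c :* f :+ d :* e) :+ b :* (c :* e :+ m :* (d :* f)))
        refl (- 1#) a b c d e f

    ⊗-distribˡ : ∀ z w v → z ⊗ (w +ᶜ v) ≈ᶜ (z ⊗ w) +ᶜ (z ⊗ v)
    ⊗-distribˡ (a +i b) (c +i d) (e +i f) =
      solve 7 (λ m a b c d e f → a :* (c :+ e) :+ m :* (b :* (d :+ f))
                              := (a :* c :+ m :* (b :* d)) :+ (a :* e :+ m :* (b :* f)))
        refl (- 1#) a b c d e f ,
      solve 6 (λ a b c d e f → a :* (d :+ f) :+ b :* (c :+ e) := (a :* d :+ b :* c) :+ (a :* f :+ b :* e))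
        refl a b c d e f

    ≈-trans : ∀ {z w v} → z ≈ᶜ w → w ≈ᶜ v → z ≈ᶜ v
    ≈-trans (p , q) (r , s) = trans p r , trans q s

    ≈-sym : ∀ {z w} → z ≈ᶜ w → w ≈ᶜ z
    ≈-sym (p , q) = sym p , sym q

    +ᶜ-cong : ∀ {z z′ w w′} → z ≈ᶜ z′ → w ≈ᶜ w′ → z +ᶜ w ≈ᶜ z′ +ᶜ w′
    +ᶜ-cong (p , q) (r , s) = +-cong p r , +-cong q s

    *ᶜ-comm : ∀ z w → z *ᶜ w ≈ᶜ w *ᶜ z
    *ᶜ-comm (a +i b) (c +i d) = +-cong (*-comm a c) (-‿cong (*-comm b d))
                              , trans (+-comm (a * d) (b * c)) (+-cong (*-comm b c) (*-comm a d))

    *ᶜ-assoc : ∀ z w v → (z *ᶜ w) *ᶜ v ≈ᶜ z *ᶜ (w *ᶜ v)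
    *ᶜ-assoc z w v =
      ≈-trans (*≈⊗ (z *ᶜ w) v) (≈-trans (⊗-cong (*≈⊗ z w) (refl , refl)) (≈-trans (⊗-assoc z w v)
        (≈-trans (⊗-cong (refl , refl) (≈-sym (*≈⊗ w v))) (≈-sym (*≈⊗ z (w *ᶜ v))))))

    *ᶜ-distribˡ : ∀ z w v → z *ᶜ (w +ᶜ v) ≈ᶜ z *ᶜ w +ᶜ z *ᶜ v
    *ᶜ-distribˡ z w v =
      ≈-trans (*≈⊗ z (w +ᶜ v)) (≈-trans (⊗-distribˡ z w v) (+ᶜ-cong (≈-sym (*≈⊗ z w)) (≈-sym (*≈⊗ z v))))

    *ᶜ-distribʳ : ∀ z w v → (w +ᶜ v) *ᶜ z ≈ᶜ w *ᶜ z +ᶜ v *ᶜ z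
    *ᶜ-distribʳ z w v =
      ≈-trans (*ᶜ-comm (w +ᶜ v) z) (≈-trans (*ᶜ-distribˡ z w v) (+ᶜ-cong (*ᶜ-comm z w) (*ᶜ-comm z v)))

    *ᶜ-identityˡ : ∀ z → 1ᶜ *ᶜ z ≈ᶜ z
    *ᶜ-identityˡ (a +i b) = trans (+-cong (*-identityˡ a) (-‿cong (zeroˡ b))) (x-0≈x a)
                          , trans (+-cong (*-identityˡ b) (zeroˡ a)) (+-identityʳ b)

  isCommutativeRing : IsCommutativeRing _≈ᶜ_ _+ᶜ_ _*ᶜ_ -ᶜ_ 0ᶜ 1ᶜ
  isCommutativeRing = record
    { isRing = record
      { +-isAbelianGroup = record
        { isGroup = record
          { isMonoid = record
            { isSemigroup = record
              { isMagma = record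
                { isEquivalence = record { refl = refl , refl ; sym = ≈-sym ; trans = ≈-trans }
                ; ∙-cong = +ᶜ-cong
                }
              ; assoc = λ (a +i b) (c +i d) (e +i f) → +-assoc a c e , +-assoc b d f
              }
            ; identity = (λ (a +i b) → +-identityˡ a , +-identityˡ b)
                       , (λ (a +i b) → +-identityʳ a , +-identityʳ b)
            }
          ; inverse = (λ (a +i b) → -‿inverseˡ a , -‿inverseˡ b)
                    , (λ (a +i b) → -‿inverseʳ a , -‿inverseʳ b)
          ; ⁻¹-cong = λ (p , q) → -‿cong p , -‿cong q
          }
        ; comm = λ (a +i b) (c +i d) → +-comm a c , +-comm b d
        }
      ; *-cong = λ (p , q) (r , s) → +-cong (*-cong p r) (-‿cong (*-cong q s)) , +-cong (*-cong p s) (*-cong q r)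
      ; *-assoc = *ᶜ-assoc
      ; *-identity = *ᶜ-identityˡ , (λ z → ≈-trans (*ᶜ-comm z 1ᶜ) (*ᶜ-identityˡ z))
      ; distrib = *ᶜ-distribˡ , *ᶜ-distribʳ
      }
    ; *-comm = *ᶜ-comm
    }

  private

    #-sym′ : ∀ {z w} → z #ᶜ w → w #ᶜ z
    #-sym′ (inj₁ p) = inj₁ (#-sym p)
    #-sym′ (inj₂ p) = inj₂ (#-sym p)

    #-irrefl′ : ∀ {z w} → z ≈ᶜ w → ¬ z #ᶜ w
    #-irrefl′ (p , q) = [ #-irrefl p , #-irrefl q ]′

    #-cotrans′ : Cotransitive _#ᶜ_
    #-cotrans′ (inj₁ p) w = [ (λ r → inj₁ (inj₁ r)) , (λ r → inj₂ (inj₁ r)) ]′ (#-cotrans p (re w))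
    #-cotrans′ (inj₂ p) w = [ (λ r → inj₁ (inj₂ r)) , (λ r → inj₂ (inj₂ r)) ]′ (#-cotrans p (im w))

    x-y#0 : ∀ {x y} → x # y → x - y # 0#
    x-y#0 {x} {y} x#y with #⇒invertible x#y
    ... | v , p , q = invertible⇒# (v , trans (*-cong refl (x-0≈x (x - y))) p , trans (*-cong (x-0≈x (x - y)) refl) q)

    factor# : ∀ v x y → v * (x - y) # 0# → x # y
    factor# v x y p with #⇒invertible p
    ... | u , q , _ = invertible⇒# (u * v , eq , trans (*-comm (x - y) (u * v)) eq)
      where
      eq : u * v * (x - y) ≈ 1#
      eq = trans (*-assoc u v (x - y)) (trans (*-congˡ (sym (x-0≈x (v * (x - y))))) q)

    #⇒invertible′ : ∀ {z w} → z #ᶜ w → Invertible _≈ᶜ_ 1ᶜ _*ᶜ_ (z -ᶜ w)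
    #⇒invertible′ {z} {w} z#w with #⇒invertible (norm#0 (re z - re w) (im z - im w) ([ (λ p → inj₁ (x-y#0 p)) , (λ p → inj₂ (x-y#0 p)) ]′ z#w))
    ... | v , vN≈1 , _ = u , eq , ≈-trans (*ᶜ-comm (z -ᶜ w) u) eq
      where
      a b : Carrier
      a = re z - re w
      b = im z - im w
      u : ℂ
      u = (v * a) +i (- (v * b))
      neg² : - (- (v * b) * b) ≈ v * b * b
      neg² = trans (-‿cong (sym (-‿distribˡ-* (v * b) b))) (-‿involutive (v * b * b))
      eq : u *ᶜ (z -ᶜ w) ≈ᶜ 1ᶜ
      eq = trans (+-congˡ neg²) (trans (solve 3 (λ v a b → v :* a :* a :+ v :* b :* b := v :* (a :* a :+ b :* b)) refl v a b)
                               (trans (*-congˡ (sym (x-0≈x (a * a + b * b)))) vN≈1))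
         , trans (+-cong (solve 3 (λ v a b → v :* a :* b := v :* b :* a) refl v a b) (sym (-‿distribˡ-* (v * b) a)))
                 (-‿inverseʳ (v * b * a))

    invertible⇒#′ : ∀ {z w} → Invertible _≈ᶜ_ 1ᶜ _*ᶜ_ (z -ᶜ w) → z #ᶜ w
    invertible⇒#′ {z} {w} (v , (p , _) , _) with #-cotrans (#-congʳ (sym p) 1#0) (- (im v * (im z - im w)))
    ... | inj₁ q = inj₁ (factor# (re v) (re z) (re w) (#-congʳ cancel (x-y#0 q)))
      where
      s t : Carrier
      s = re v * (re z - re w)
      t = im v * (im z - im w)
      cancel : s - t - - t ≈ s
      cancel = trans (+-assoc s (- t) (- - t)) (trans (+-congˡ (-‿inverseʳ (- t))) (+-identityʳ s))
    ... | inj₂ q = inj₂ (factor# (- im v) (im z) (im w) (#-congʳ (-‿distribˡ-* (im v) (im z - im w)) q))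

  ℂ-heytingField : HeytingField c ℓ₁ ℓ₂
  ℂ-heytingField = record
    { isHeytingField = record
      { isHeytingCommutativeRing = record
        { isCommutativeRing = isCommutativeRing
        ; isApartnessRelation = record
          { irrefl  = #-irrefl′
          ; sym     = #-sym′
          ; cotrans = #-cotrans′
          }
        ; #⇒invertible = #⇒invertible′
        ; invertible⇒# = invertible⇒#′
        }
      ; tight = λ z w → (λ ¬p → proj₁ (tight (re z) (re w)) (λ q → ¬p (inj₁ q))
                              , proj₁ (tight (im z) (im w)) (λ q → ¬p (inj₂ q)))
                      , #-irrefl′
      }
    }

  open import Algebra.Definitions.RawMonoid (CommutativeRing.+-rawMonoid (toCommutativeRing R)) using () renaming (_×_ to _·_)
  open import Algebra.Definitions.RawMonoid (CommutativeRing.+-rawMonoid (toCommutativeRing ℂ-heytingField)) using () renaming (_×_ to _·ᶜ_)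

  characteristicZero : CharacteristicZero R → CharacteristicZero ℂ-heytingField
  characteristicZero h n = inj₁ (subst (_# 0#) (sym≡ (re-· n)) (h n))
    where
    open import Relation.Binary.PropositionalEquality using (_≡_; subst; cong) renaming (refl to refl≡; sym to sym≡)
    re-· : ∀ n → re (n ·ᶜ 1ᶜ) ≡ n · 1#
    re-· zero    = refl≡
    re-· (suc n) = cong (1# +_) (re-· n)

module FieldNotation {c ℓ₁ ℓ₂} (F : HeytingField c ℓ₁ ℓ₂) (characteristicZero : CharacteristicZero F) where

  open HeytingField F using (Carrier; _≈_; _#_; _+_; _*_; -_; _-_; 0#; 1#; +-cong; +-congˡ; +-assoc; +-comm; +-identityʳ; -‿inverseʳ; *-comm; *-congˡ; refl; sym; trans; #⇒invertible; heytingCommutativeRing)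
  open CommutativeRing (toCommutativeRing F) using (setoid; ring; +-monoid; semiring)
  open import Algebra.Definitions.RawSemiring (Semiring.rawSemiring semiring) using (_^_; sum; product) renaming (_×_ to _·_)
  open import Algebra.Apartness.Properties.HeytingCommutativeRing heytingCommutativeRing using (x-0≈x; 1#0; x#0y#0→xy#0; #-congʳ; invertibleˡ⇒#)
  open import Algebra.Properties.Monoid.Mult +-monoid using (×-homo-+)
  open import Algebra.Properties.Ring ring using (-‿involutive)
  open import Relation.Binary.PropositionalEquality using (cong) renaming (sym to sym≡)
  open import Relation.Binary.Reasoning.Setoid setoid

  infix 9 ↑_

  ↑_ : ℕ → Carrier
  ↑ n = n · 1#

  -- The proof of d # 0# supplies the inverse of d, which is unique up to _≈_
  infixl 7 _/_[_]

  _/_[_] : Carrier → (d : Carrier) → d # 0# → Carrier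
  a / d [ d#0 ] = a * proj₁ (#⇒invertible d#0)

  -- Both ends are included; the summand may use k ≤ n to justify its denominators
  ∑[0‥_] : ∀ n → (∀ k → k ℕ.≤ n → Carrier) → Carrier
  ∑[0‥ n ] f = sum {suc n} (λ i → f (toℕ i) (Finₚ.toℕ≤pred[n] i))

  infix 4 _∉-[1‥_] _∉-[0‥_]

  -- u ∉ {-1, …, -n}, and below u ∉ {0, -1, …, -n}, with apartness as the negation of equality
  _∉-[1‥_] : Carrier → ℕ → Set ℓ₂
  u ∉-[1‥ n ] = ∀ k → 1 ℕ.≤ k → k ℕ.≤ n → u # - ↑ k

  _∉-[0‥_] : Carrier → ℕ → Set ℓ₂
  u ∉-[0‥ n ] = ∀ k → k ℕ.≤ n → u # - ↑ k

  ∉-mono : ∀ {u k n} → k ℕ.≤ n → u ∉-[1‥ n ] → u ∉-[1‥ k ]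
  ∉-mono k≤n u∉ j 1≤j j≤k = u∉ j 1≤j (ℕₚ.≤-trans j≤k k≤n)

  /#0 : ∀ {a d} (d#0 : d # 0#) → a # 0# → a / d [ d#0 ] # 0#
  /#0 {a} {d} d#0 a#0 with #⇒invertible d#0
  ... | e , ed≈1 , _ = x#0y#0→xy#0 a#0
    (invertibleˡ⇒# (d , trans (*-congˡ (x-0≈x e)) (trans (*-comm d e) (trans (*-congˡ (sym (x-0≈x d))) ed≈1))))

  ^#0 : ∀ {u} m → u # 0# → u ^ m # 0#
  ^#0 zero    u#0 = 1#0
  ^#0 (suc m) u#0 = x#0y#0→xy#0 u#0 (^#0 m u#0)

  product#0 : ∀ {n} (t : Fin n → Carrier) → (∀ i → t i # 0#) → product t # 0#
  product#0 {zero}  t t#0 = 1#0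
  product#0 {suc n} t t#0 = x#0y#0→xy#0 (t#0 Fin.zero) (product#0 (λ i → t (Fin.suc i)) (λ i → t#0 (Fin.suc i)))

  -#0 : ∀ {u v} → u # v → u - v # 0#
  -#0 {u} {v} u#v with #⇒invertible u#v
  ... | e , p , _ = invertibleˡ⇒# (e , trans (*-congˡ (x-0≈x (u - v))) p)

  +↑#0 : ∀ {u} k → u # - ↑ k → u + ↑ k # 0#
  +↑#0 k u#-k = #-congʳ (+-congˡ (-‿involutive (↑ k))) (-#0 u#-k)

  -- H⟨ ℓ ⟩ n u is Σ_{k=1}^{n} 1 / (u + k)^ℓ; the index i stands for k - 1
  H⟨_⟩ : (ℓ n : ℕ) (u : Carrier) → u ∉-[1‥ n ] → Carrier
  H⟨ ℓ ⟩ n u u∉ = sum {n} λ i →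
    1# / (u + ↑ suc (toℕ i)) ^ ℓ [ ^#0 ℓ (+↑#0 (suc (toℕ i)) (u∉ (suc (toℕ i)) (ℕ.s≤s ℕ.z≤n) (Finₚ.toℕ<n i))) ]

  k!#0 : ∀ k → ↑ (k !) # 0#
  k!#0 k = characteristicZero (k !) {{k ℕₚ.!≢0}}

  -- u (u - 1) ⋯ (u - k + 1) / k!
  binom : Carrier → ℕ → Carrier
  binom u k = product {k} (λ i → u - ↑ toℕ i) / ↑ (k !) [ k!#0 k ]

  binom#0 : ∀ {u} k → u ∉-[1‥ k ] → binom (u + ↑ k) k # 0#
  binom#0 {u} k u∉ = /#0 (k!#0 k) (product#0 {k} (λ i → u + ↑ k - ↑ toℕ i) factor#0)
    where
    factor#0 : ∀ (i : Fin k) → u + ↑ k - ↑ toℕ i # 0#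
    factor#0 i = #-congʳ eq (+↑#0 d (u∉ d (ℕₚ.m<n⇒0<n∸m (Finₚ.toℕ<n i)) (ℕₚ.m∸n≤m k (toℕ i))))
      where
      d : ℕ
      d = k ℕ.∸ toℕ i
      eq : u + ↑ d ≈ u + ↑ k - ↑ toℕ i
      eq = sym (begin
        u + ↑ k - ↑ toℕ i                  ≡⟨ cong (λ m → u + ↑ m - ↑ toℕ i) (sym≡ (ℕₚ.m∸n+n≡m (ℕₚ.<⇒≤ (Finₚ.toℕ<n i)))) ⟩
        u + ↑ (d ℕ.+ toℕ i) - ↑ toℕ i      ≈⟨ +-assoc u (↑ (d ℕ.+ toℕ i)) (- ↑ toℕ i) ⟩
        u + (↑ (d ℕ.+ toℕ i) - ↑ toℕ i)    ≈⟨ +-congˡ (+-cong (×-homo-+ 1# d (toℕ i)) refl) ⟩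
        u + (↑ d + ↑ toℕ i - ↑ toℕ i)      ≈⟨ +-congˡ (+-assoc (↑ d) (↑ toℕ i) (- ↑ toℕ i)) ⟩
        u + (↑ d + (↑ toℕ i - ↑ toℕ i))    ≈⟨ +-congˡ (+-congˡ (-‿inverseʳ (↑ toℕ i))) ⟩
        u + (↑ d + 0#)                     ≈⟨ +-congˡ (+-identityʳ (↑ d)) ⟩
        u + ↑ d                            ∎)

  [y+k-1][y+k]#0 : ∀ {y n} k → y # 1# → y ∉-[0‥ n ] → k ℕ.≤ n → (y + ↑ k - 1#) * (y + ↑ k) # 0#
  [y+k-1][y+k]#0 {y} {n} k y#1 y∉ k≤n = x#0y#0→xy#0 (left k k≤n) (+↑#0 k (y∉ k k≤n))
    where
    left : ∀ k → k ℕ.≤ n → y + ↑ k - 1# # 0#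
    left zero    _   = #-congʳ (+-cong (sym (+-identityʳ y)) refl) (-#0 y#1)
    left (suc k) k<n = #-congʳ (sym eq) (+↑#0 k (y∉ k (ℕₚ.<⇒≤ k<n)))
      where
      eq : y + (1# + ↑ k) - 1# ≈ y + ↑ k
      eq = begin
        y + (1# + ↑ k) - 1#   ≈⟨ +-assoc y (1# + ↑ k) (- 1#) ⟩
        y + (1# + ↑ k - 1#)   ≈⟨ +-congˡ (+-cong (+-comm 1# (↑ k)) refl) ⟩
        y + (↑ k + 1# - 1#)   ≈⟨ +-congˡ (+-assoc (↑ k) 1# (- 1#)) ⟩
        y + (↑ k + (1# - 1#)) ≈⟨ +-congˡ (+-congˡ (-‿inverseʳ 1#)) ⟩
        y + (↑ k + 0#)        ≈⟨ +-congˡ (+-identityʳ (↑ k)) ⟩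
        y + ↑ k               ∎

-- Opaque so that the construction does not unfold during type checking
opaque
  ℂ-heytingField : HeytingField 0ℓ 0ℓ 0ℓ
  ℂ-heytingField = Complexification.ℂ-heytingField Real.ℝ-heytingField Real.norm#0

opaque
  unfolding ℂ-heytingField

  ℂ-characteristicZero : CharacteristicZero ℂ-heytingField
  ℂ-characteristicZero = Complexification.characteristicZero Real.ℝ-heytingField Real.norm#0 Real.characteristicZero

open HeytingField ℂ-heytingField public
  using (_≈_; _#_; _+_; _*_; -_; _-_; 0#; 1#) renaming (Carrier to ℂ)

open import Algebra.Definitions.RawSemiring (Semiring.rawSemiring (CommutativeRing.semiring (toCommutativeRing ℂ-heytingField))) public
  using (_^_)

open FieldNotation ℂ-heytingField ℂ-characteristicZero public
  using (↑_; _/_[_]; ∑[0‥_]; _∉-[1‥_]; _∉-[0‥_]; ∉-mono; ^#0; H⟨_⟩; binom; binom#0; [y+k-1][y+k]#0)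

{-# OPTIONS --safe #-}

-- With b = y - 1, m = 1 + x - y and c = 2m + b, the summand without its harmonic factor is
-- (-n)ₖ (n + c)ₖ (b)ₖ / (k! (x + 1)ₖ²), and the theorem is the ε²-coefficient of a summation in which
-- (x + 1)ₖ² is replaced by (x + 1 + ε)ₖ (x + 1 - ε)ₖ. Both the constant and the ε²-coefficient are
-- evaluated by one induction on n. For an arbitrary sequence β, the sum ⟨ n , c ⟩ β of
-- (-n)ₖ (n + c)ₖ βₖ / k! satisfies
--   ⟨ n + 1 , c ⟩ β = ⟨ n , c ⟩ β - (2n + c + 1) ⟨ n , c + 1 ⟩ (β ∘ suc),
-- and shifting β amounts to replacing (x , b , c) by (x + 1 , b + 1 , c + 1), which leaves m fixed.
module Submission where

open import Algebra.Apartness.Bundles using (HeytingField)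
open import Algebra.Bundles using (CommutativeRing; Monoid; Semiring)
open import Data.Fin.Base using (Fin; toℕ)
import Data.Fin.Properties as Finₚ
open import Data.Integer.Base as ℤ using (ℤ; +_; -[1+_])
import Data.Integer.Properties as ℤₚ
open import Data.Nat.Base as ℕ using (ℕ; zero; suc; _<_; _≤_; s≤s; z≤n; _!)
import Data.Nat.Properties as ℕₚ
open import Data.Product.Base using (Σ-syntax; _,_; proj₁; proj₂)
open import Function.Base using (_∘_)
import Relation.Binary.PropositionalEquality.Core as ≡

-- Ring solver with integer coefficients over a commutative ring

module IntegerCoefficientSolver {c ℓ} (R : CommutativeRing c ℓ) where

  open import Algebra.Solver.Ring.AlmostCommutativeRing
    using (_-Raw-AlmostCommutative⟶_; fromCommutativeRing)
  open CommutativeRing R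
  open import Algebra.Properties.Ring ring
    using (-0#≈0#; -‿involutive; -‿+-comm; -‿distribˡ-*; -‿distribʳ-*)
  open import Algebra.Properties.Semiring.Mult.TCOptimised semiring
    using (_×_; 1+×; ×-homo-+; ×1-homo-*)
  open import Data.Maybe.Base using (Maybe; map)
  open import Relation.Binary.Consequences using (dec⇒weaklyDec)
  open import Relation.Binary.Reasoning.Setoid setoid

  -- With the optimised multiple, `1 × 1#` computes to `1#`, so `con (+ 1)` and `con -[1+ 0 ]`
  -- evaluate to `1#` and `- 1#` themselves, and solver equations match the goals as they are
  -- written.
  ⟦_⟧ℤ : ℤ → Carrier
  ⟦ + n ⟧ℤ      = n × 1#
  ⟦ -[1+ n ] ⟧ℤ = - (suc n × 1#)

  -‿homo : ∀ i → ⟦ ℤ.- i ⟧ℤ ≈ - ⟦ i ⟧ℤ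
  -‿homo (+ zero)  = sym -0#≈0#
  -‿homo (+ suc n) = refl
  -‿homo -[1+ n ]  = sym (-‿involutive (suc n × 1#))

  ⊖-homo : ∀ m n → ⟦ m ℤ.⊖ n ⟧ℤ ≈ m × 1# - n × 1#
  ⊖-homo m       zero    = sym (trans (+-congˡ -0#≈0#) (+-identityʳ (m × 1#)))
  ⊖-homo zero    (suc n) = sym (+-identityˡ (- (suc n × 1#)))
  ⊖-homo (suc m) (suc n) = begin
    ⟦ suc m ℤ.⊖ suc n ⟧ℤ          ≡⟨ ≡.cong ⟦_⟧ℤ (ℤₚ.[1+m]⊖[1+n]≡m⊖n m n) ⟩
    ⟦ m ℤ.⊖ n ⟧ℤ                  ≈⟨ ⊖-homo m n ⟩
    M - N                         ≈⟨ +-congʳ (+-identityʳ M) ⟨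
    M + 0# - N                    ≈⟨ +-congʳ (+-congˡ (-‿inverseʳ 1#)) ⟨
    M + (1# - 1#) - N             ≈⟨ +-congʳ (+-assoc M 1# (- 1#)) ⟨
    M + 1# - 1# - N               ≈⟨ +-assoc (M + 1#) (- 1#) (- N) ⟩
    M + 1# + (- 1# - N)           ≈⟨ +-cong (+-comm M 1#) (-‿+-comm 1# N) ⟩
    1# + M - (1# + N)             ≈⟨ +-cong (1+× m 1#) (-‿cong (1+× n 1#)) ⟨
    suc m × 1# - suc n × 1#       ∎
    where
    M N : Carrier
    M = m × 1#
    N = n × 1#

  +-homo : ∀ i j → ⟦ i ℤ.+ j ⟧ℤ ≈ ⟦ i ⟧ℤ + ⟦ j ⟧ℤ
  +-homo (+ m)    (+ n)    = ×-homo-+ 1# m n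
  +-homo (+ m)    -[1+ n ] = ⊖-homo m (suc n)
  +-homo -[1+ m ] (+ n)    = trans (⊖-homo n (suc m)) (+-comm (n × 1#) (- (suc m × 1#)))
  +-homo -[1+ m ] -[1+ n ] = begin
    - (suc (suc (m ℕ.+ n)) × 1#)       ≡⟨ ≡.cong (λ k → - (suc k × 1#)) (ℕₚ.+-suc m n) ⟨
    - ((suc m ℕ.+ suc n) × 1#)         ≈⟨ -‿cong (×-homo-+ 1# (suc m) (suc n)) ⟩
    - (suc m × 1# + suc n × 1#)        ≈⟨ -‿+-comm (suc m × 1#) (suc n × 1#) ⟨
    - (suc m × 1#) - suc n × 1#        ∎

  *-homo : ∀ i j → ⟦ i ℤ.* j ⟧ℤ ≈ ⟦ i ⟧ℤ * ⟦ j ⟧ℤ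
  *-homo (+ m) (+ n) = begin
    ⟦ + m ℤ.* + n ⟧ℤ ≡⟨ ≡.cong ⟦_⟧ℤ (ℤₚ.+◃n≡+n (m ℕ.* n)) ⟩
    (m ℕ.* n) × 1#   ≈⟨ ×1-homo-* m n ⟩
    m × 1# * (n × 1#) ∎
  *-homo (+ m) -[1+ n ] = begin
    ⟦ + m ℤ.* -[1+ n ] ⟧ℤ         ≡⟨ ≡.cong ⟦_⟧ℤ (ℤₚ.-◃n≡-n (m ℕ.* suc n)) ⟩
    ⟦ ℤ.- + (m ℕ.* suc n) ⟧ℤ      ≈⟨ -‿homo (+ (m ℕ.* suc n)) ⟩
    - ((m ℕ.* suc n) × 1#)        ≈⟨ -‿cong (×1-homo-* m (suc n)) ⟩
    - (m × 1# * (suc n × 1#))     ≈⟨ -‿distribʳ-* (m × 1#) (suc n × 1#) ⟩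
    m × 1# * - (suc n × 1#)       ∎
  *-homo -[1+ m ] (+ n) = begin
    ⟦ -[1+ m ] ℤ.* + n ⟧ℤ         ≡⟨ ≡.cong ⟦_⟧ℤ (ℤₚ.-◃n≡-n (suc m ℕ.* n)) ⟩
    ⟦ ℤ.- + (suc m ℕ.* n) ⟧ℤ      ≈⟨ -‿homo (+ (suc m ℕ.* n)) ⟩
    - ((suc m ℕ.* n) × 1#)        ≈⟨ -‿cong (×1-homo-* (suc m) n) ⟩
    - (suc m × 1# * (n × 1#))     ≈⟨ -‿distribˡ-* (suc m × 1#) (n × 1#) ⟩
    - (suc m × 1#) * (n × 1#)     ∎
  *-homo -[1+ m ] -[1+ n ] = begin
    (suc m ℕ.* suc n) × 1#            ≈⟨ ×1-homo-* (suc m) (suc n) ⟩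
    M * N                             ≈⟨ -‿involutive (M * N) ⟨
    - - (M * N)                       ≈⟨ -‿cong (-‿distribʳ-* M N) ⟩
    - (M * - N)                       ≈⟨ -‿distribˡ-* M (- N) ⟩
    - M * - N                         ∎
    where
    M N : Carrier
    M = suc m × 1#
    N = suc n × 1#

  homomorphism : ℤ.+-*-rawRing -Raw-AlmostCommutative⟶ fromCommutativeRing R
  homomorphism = record
    { ⟦_⟧    = ⟦_⟧ℤ
    ; +-homo = +-homo
    ; *-homo = *-homo
    ; -‿homo = -‿homo
    ; 0-homo = refl
    ; 1-homo = refl
    }

  weaklyDecidable : ∀ i j → Maybe (⟦ i ⟧ℤ ≈ ⟦ j ⟧ℤ)
  weaklyDecidable i j = map (λ i≡j → reflexive (≡.cong ⟦_⟧ℤ i≡j)) (dec⇒weaklyDec ℤₚ._≟_ i j)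

  open import Algebra.Solver.Ring ℤ.+-*-rawRing (fromCommutativeRing R) homomorphism weaklyDecidable public

-- Sums and products over initial segments of ℕ

module RangeFold {a ℓ} (M : Monoid a ℓ) where
  open Monoid M
  open import Algebra.Definitions.RawMonoid rawMonoid using (sum)

  -- Sequences on ℕ rather than on `Fin n` make removal of the first entry the shift `f ∘ suc`, on
  -- which the whole induction rests.
  fold< : ℕ → (ℕ → Carrier) → Carrier
  fold< n f = sum {n} (λ i → f (toℕ i))

  fold<-cong : ∀ n {f g : ℕ → Carrier} → (∀ k → k < n → f k ≈ g k) → fold< n f ≈ fold< n g
  fold<-cong zero    f≈g = refl
  fold<-cong (suc n) f≈g = ∙-cong (f≈g 0 (s≤s z≤n)) (fold<-cong n (λ k k<n → f≈g (suc k) (s≤s k<n)))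

  fold<-last : ∀ n (f : ℕ → Carrier) → fold< (suc n) f ≈ fold< n f ∙ f n
  fold<-last zero    f = trans (identityʳ (f 0)) (sym (identityˡ (f 0)))
  fold<-last (suc n) f = trans (∙-congˡ (fold<-last n (f ∘ suc))) (sym (assoc (f 0) (fold< n (f ∘ suc)) (f (suc n))))

-- Recurrence in n for hypergeometric sums with arbitrary weights

-- invFact k stands for 1 / k!
module HypergeometricSum {c ℓ} (R : CommutativeRing c ℓ) (invFact : ℕ → CommutativeRing.Carrier R) where

  open CommutativeRing R
  open import Algebra.Definitions.RawSemiring (Semiring.rawSemiring semiring) using (_^_) renaming (_×_ to _·_)
  open import Relation.Binary.Reasoning.Setoid setoid
  open IntegerCoefficientSolver R using (solve; _:=_; _:+_; _:-_; _:*_; :-_; con)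
  open RangeFold +-monoid public using ()
    renaming (fold< to ∑<; fold<-last to ∑<-last)
  open RangeFold *-monoid public using ()
    renaming (fold< to ∏<; fold<-cong to ∏<-cong; fold<-last to ∏<-last)

  infix 9 ↑_
  ↑_ : ℕ → Carrier
  ↑ n = n · 1#

  ∑<-linear : ∀ n (f g h : ℕ → Carrier) x y → (∀ k → k < n → f k ≈ x * g k + y * h k) →
              ∑< n f ≈ x * ∑< n g + y * ∑< n h
  ∑<-linear zero    f g h x y f≈ = solve 2 (λ x y → con (+ 0) := x :* con (+ 0) :+ y :* con (+ 0)) refl x y
  ∑<-linear (suc n) f g h x y f≈ = begin
    f 0 + ∑< n (f ∘ suc)
      ≈⟨ +-cong (f≈ 0 (s≤s z≤n)) (∑<-linear n (f ∘ suc) (g ∘ suc) (h ∘ suc) x y (λ k k<n → f≈ (suc k) (s≤s k<n))) ⟩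
    x * g 0 + y * h 0 + (x * ∑< n (g ∘ suc) + y * ∑< n (h ∘ suc))
      ≈⟨ solve 6 (λ x y g₀ h₀ G H → x :* g₀ :+ y :* h₀ :+ (x :* G :+ y :* H)
                                 := x :* (g₀ :+ G) :+ y :* (h₀ :+ H)) refl x y (g 0) (h 0) _ _ ⟩
    x * (g 0 + ∑< n (g ∘ suc)) + y * (h 0 + ∑< n (h ∘ suc)) ∎

  rising : Carrier → ℕ → Carrier
  rising u k = ∏< k (λ j → u + ↑ j)

  falling : Carrier → ℕ → Carrier
  falling u k = ∏< k (λ j → u - ↑ j)

  rising-cong : ∀ {u u′} → u ≈ u′ → ∀ k → rising u k ≈ rising u′ k
  rising-cong u≈u′ k = ∏<-cong k (λ j _ → +-congʳ {↑ j} u≈u′)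

  rising-head : ∀ u k → rising u (suc k) ≈ u * rising (u + 1#) k
  rising-head u k = *-cong (+-identityʳ u) (∏<-cong k (λ j _ → sym (+-assoc u 1# (↑ j))))

  falling-head : ∀ u k → falling (1# + u) (suc k) ≈ (1# + u) * falling u k
  falling-head u k = *-cong (solve 1 (λ u → con (+ 1) :+ u :- con (+ 0) := con (+ 1) :+ u) refl u)
    (∏<-cong k (λ j _ → solve 2 (λ u j → con (+ 1) :+ u :- (con (+ 1) :+ j) := u :- j) refl u (↑ j)))

  falling-self≈0 : ∀ n → falling (↑ n) (suc n) ≈ 0#
  falling-self≈0 n = trans (∏<-last n (λ j → ↑ n - ↑ j)) (trans (*-congˡ (-‿inverseʳ (↑ n))) (zeroʳ (falling (↑ n) n)))

  -- (-ν)ₖ (α)ₖ / k!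
  coef : Carrier → Carrier → ℕ → Carrier
  coef ν α k = (- 1#) ^ k * (falling ν k * invFact k) * rising α k

  coef-cong : ∀ {ν α α′} → α ≈ α′ → ∀ k → coef ν α k ≈ coef ν α′ k
  coef-cong α≈α′ k = *-congˡ (rising-cong α≈α′ k)

  ⟨_,_⟩ : ℕ → Carrier → (ℕ → Carrier) → Carrier
  ⟨ n , c ⟩ β = ∑< (suc n) (λ k → coef (↑ n) (↑ n + c) k * β k)

  -- In the application `w j` is 1 / (x + 1 + j)², which makes this (b)ₖ / (x + 1)ₖ². With `w` an
  -- arbitrary sequence, replacing x by x + 1 is just `w ∘ suc`.
  term : Carrier → (ℕ → Carrier) → ℕ → Carrier
  term b w k = rising b k * ∏< k w

  -- The ε²-coefficient of (b)ₖ / ∏ ((x + 1 + j)² - ε²): each factor 1 / (a² - ε²) expands as a⁻² (1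
  -- + a⁻² ε² + ...), so the coefficient is the constant term times the sum of the a⁻².
  termH : Carrier → (ℕ → Carrier) → ℕ → Carrier
  termH b w k = term b w k * ∑< k w

  module _ (invFact-zero : invFact 0 ≈ 1#) (invFact-suc : ∀ k → ↑ suc k * invFact (suc k) ≈ invFact k) where

    -- Once the common factors are taken out, what remains is (1 + ν)(1 + α + k) = α (ν - k) + (ν +
    -- α + 1)(1 + k); the last factor 1 + k turns `invFact (suc k)` into `invFact k`.
    coef-suc : ∀ ν α k → coef (1# + ν) (1# + α) (suc k) ≈ coef ν α (suc k) - (ν + α + 1#) * coef ν (1# + α) k
    coef-suc ν α k = begin
      - 1# * s * (falling (1# + ν) (suc k) * i) * rising (1# + α) (suc k)
        ≈⟨ *-cong (*-congˡ (*-congʳ (falling-head ν k))) (∏<-last k (λ j → 1# + α + ↑ j)) ⟩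
      - 1# * s * ((1# + ν) * f * i) * (r * (1# + α + ↑ k))
        ≈⟨ solve 7 (λ s f i r ν α k → let 1' = con (+ 1) ; -1' = con -[1+ 0 ] in
             -1' :* s :* ((1' :+ ν) :* f :* i) :* (r :* (1' :+ α :+ k))
             := -1' :* s :* (f :* (ν :- k) :* i) :* (α :* r) :- (ν :+ α :+ 1') :* (s :* (f :* ((1' :+ k) :* i)) :* r))
             refl s f i r ν α (↑ k) ⟩
      - 1# * s * (f * (ν - ↑ k) * i) * (α * r) - (ν + α + 1#) * (s * (f * (↑ suc k * i)) * r)
        ≈⟨ +-cong (*-cong (*-congˡ (*-congʳ (∏<-last k (λ j → ν - ↑ j)))) (trans (rising-head α k) (*-congˡ (rising-cong (+-comm α 1#) k))))
                  (-‿cong (*-congˡ (*-congʳ (*-congˡ (*-congˡ (sym (invFact-suc k))))))) ⟨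
      coef ν α (suc k) - (ν + α + 1#) * coef ν (1# + α) k ∎
      where
      s f i r : Carrier
      s = (- 1#) ^ k
      f = falling ν k
      i = invFact (suc k)
      r = rising (1# + α) k

    -- Entry 0 of `coef` is independent of both parameters, and `coef-suc` treats all later entries;
    -- its correction term is a sum over the shifted sequence.
    ⟨⟩-suc : ∀ n c β → ⟨ suc n , c ⟩ β ≈ ⟨ n , c ⟩ β - (↑ n + ↑ n + c + 1#) * ⟨ n , c + 1# ⟩ (β ∘ suc)
    ⟨⟩-suc n c β = begin
      t₀ + ∑< (suc n) (λ k → coef (1# + ν) (1# + ν + c) (suc k) * β (suc k))
        ≈⟨ +-congˡ (∑<-linear (suc n) _ (λ k → coef ν α (suc k) * β (suc k)) (λ k → coef ν (ν + (c + 1#)) k * β (suc k)) 1# (- κ) step) ⟩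
      t₀ + (1# * T + - κ * X)
        ≈⟨ solve 4 (λ t T κ X → t :+ (con (+ 1) :* T :+ :- κ :* X) := t :+ T :- κ :* X) refl t₀ T κ X ⟩
      t₀ + T - κ * X
        -- `t₀ + T` runs up to index n + 1, one further than `⟨ n , c ⟩ β`. The surplus term
        -- vanishes because (-n)ₙ₊₁ contains the factor n - n.
        ≈⟨ +-congʳ (trans (∑<-last (suc n) (λ k → coef ν α k * β k)) (trans (+-congˡ top) (+-identityʳ _))) ⟩
      ⟨ n , c ⟩ β - κ * X ∎
      where
      ν α κ t₀ T X : Carrier
      ν = ↑ n
      α = ν + c
      κ = ν + ν + c + 1#
      t₀ = coef ν α 0 * β 0
      T = ∑< (suc n) (λ k → coef ν α (suc k) * β (suc k))
      X = ⟨ n , c + 1# ⟩ (β ∘ suc)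
      step : ∀ k → k < suc n → coef (1# + ν) (1# + ν + c) (suc k) * β (suc k)
                             ≈ 1# * (coef ν α (suc k) * β (suc k)) + - κ * (coef ν (ν + (c + 1#)) k * β (suc k))
      step k _ = begin
        coef (1# + ν) (1# + ν + c) (suc k) * β (suc k)
          ≈⟨ *-congʳ (trans (coef-cong (+-assoc 1# ν c) (suc k)) (coef-suc ν α k)) ⟩
        (coef ν α (suc k) - (ν + α + 1#) * coef ν (1# + α) k) * β (suc k)
          ≈⟨ *-congʳ (+-congˡ (-‿cong (*-congˡ (coef-cong (solve 2 (λ ν c → con (+ 1) :+ (ν :+ c) := ν :+ (c :+ con (+ 1))) refl ν c) k)))) ⟩
        (coef ν α (suc k) - (ν + α + 1#) * coef ν (ν + (c + 1#)) k) * β (suc k)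
          ≈⟨ solve 5 (λ A B ν c β → (A :- (ν :+ (ν :+ c) :+ con (+ 1)) :* B) :* β
                := con (+ 1) :* (A :* β) :+ :- (ν :+ ν :+ c :+ con (+ 1)) :* (B :* β)) refl _ _ ν c (β (suc k)) ⟩
        1# * (coef ν α (suc k) * β (suc k)) + - κ * (coef ν (ν + (c + 1#)) k * β (suc k)) ∎
      top : coef ν α (suc n) * β (suc n) ≈ 0#
      top = begin
        coef ν α (suc n) * β (suc n)
          ≈⟨ *-congʳ (*-congʳ (*-congˡ (*-congʳ (falling-self≈0 n)))) ⟩
        (- 1#) ^ suc n * (0# * invFact (suc n)) * rising α (suc n) * β (suc n)
          ≈⟨ solve 4 (λ s i r β → s :* (con (+ 0) :* i) :* r :* β := con (+ 0)) refl ((- 1#) ^ suc n) (invFact (suc n)) (rising α (suc n)) (β (suc n)) ⟩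
        0# ∎

    -- Closed forms of the constant and the ε²-coefficient

    module ClosedForm (m e : Carrier) (r⁻¹ : ℕ → Carrier) (em²≈1 : e * (m * m) ≈ 1#) where

      -- As 2m + b is 1 + 2x - y, these are the two numerators on the right of the theorem. The
      -- parameter `e` stands for 1 / m² and `r⁻¹ j` for 1 / (m + j)².
      N Z : ℕ → Carrier → Carrier
      N n b = ↑ n * (↑ n + (m + m + b))
      Z n b = m * m + N n b

      -- Since m = 1 + x - y, this is n!² times the squared binomial coefficient of x - y + n over
      -- n.
      P : ℕ → Carrier
      P n = rising m n * rising m n

      -- Here m + b + 1 is x + 1. An equation in place of a division lets the condition pass to
      -- `b + 1#` and `w ∘ suc` with `m` unchanged.
      Inverse : ℕ → Carrier → (ℕ → Carrier) → Set ℓ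
      Inverse n b w = ∀ j → j < n → (m + b + 1# + ↑ j) * (m + b + 1# + ↑ j) * w j ≈ 1#

      inverse-tail : ∀ {n b w} → Inverse (suc n) b w → Inverse n (b + 1#) (w ∘ suc)
      inverse-tail {b = b} inv j j<n = trans (*-congʳ (*-cong eq eq)) (inv (suc j) (s≤s j<n))
        where
        eq : m + (b + 1#) + 1# + ↑ j ≈ m + b + 1# + ↑ suc j
        eq = solve 3 (λ m b j → m :+ (b :+ con (+ 1)) :+ con (+ 1) :+ j := m :+ b :+ con (+ 1) :+ (con (+ 1) :+ j)) refl m b (↑ j)

      inverse-init : ∀ {n b w} → Inverse (suc n) b w → Inverse n b w
      inverse-init inv j j<n = inv j (ℕₚ.m<n⇒m<1+n j<n)

      term-suc : ∀ b w k → term b w (suc k) ≈ b * w 0 * term (b + 1#) (w ∘ suc) k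
      term-suc b w k = trans (*-congʳ (rising-head b k))
        (solve 4 (λ b w r p → b :* r :* (w :* p) := b :* w :* (r :* p)) refl b (w 0) (rising (b + 1#) k) (∏< k (w ∘ suc)))

      ⟨⟩-term-suc : ∀ n c b w → ⟨ n , c ⟩ (term b w ∘ suc) ≈ b * w 0 * ⟨ n , c ⟩ (term (b + 1#) (w ∘ suc))
      ⟨⟩-term-suc n c b w = begin
        ⟨ n , c ⟩ (term b w ∘ suc)
          -- The second coefficient is 0, so `∑<-linear` acts as extraction of a constant factor.
          ≈⟨ ∑<-linear (suc n) _ f f (b * w 0) 0# (λ k _ → trans (*-congˡ (term-suc b w k))
               (solve 3 (λ a x t → a :* (x :* t) := x :* (a :* t) :+ con (+ 0) :* (a :* t)) refl _ (b * w 0) _)) ⟩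
        b * w 0 * ∑< (suc n) f + 0# * ∑< (suc n) f
          ≈⟨ solve 2 (λ x s → x :+ con (+ 0) :* s := x) refl _ _ ⟩
        b * w 0 * ∑< (suc n) f ∎
        where
        f : ℕ → Carrier
        f k = coef (↑ n) (↑ n + c) k * term (b + 1#) (w ∘ suc) k

      -- The head `w 0` of the shifted harmonic sum does not depend on k, so it splits off a
      -- multiple of the sum without harmonic factor. This is where the induction for `termH` calls
      -- on `⟨⟩-term`.
      ⟨⟩-termH-suc : ∀ n c b w → ⟨ n , c ⟩ (termH b w ∘ suc)
        ≈ b * w 0 * (w 0 * ⟨ n , c ⟩ (term (b + 1#) (w ∘ suc)) + ⟨ n , c ⟩ (termH (b + 1#) (w ∘ suc)))
      ⟨⟩-termH-suc n c b w = begin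
        ⟨ n , c ⟩ (termH b w ∘ suc)
          ≈⟨ ∑<-linear (suc n) _ f g (b * w 0 * w 0) (b * w 0) (λ k _ → trans (*-congˡ (*-congʳ (term-suc b w k)))
               (solve 5 (λ a b w t h → a :* (b :* w :* t :* (w :+ h)) := b :* w :* w :* (a :* t) :+ b :* w :* (a :* (t :* h)))
                  refl _ b (w 0) _ _)) ⟩
        b * w 0 * w 0 * ∑< (suc n) f + b * w 0 * ∑< (suc n) g
          ≈⟨ solve 4 (λ b w f g → b :* w :* w :* f :+ b :* w :* g := b :* w :* (w :* f :+ g)) refl b (w 0) _ _ ⟩
        b * w 0 * (w 0 * ∑< (suc n) f + ∑< (suc n) g) ∎
        where
        f g : ℕ → Carrier
        f k = coef (↑ n) (↑ n + c) k * term (b + 1#) (w ∘ suc) k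
        g k = coef (↑ n) (↑ n + c) k * termH (b + 1#) (w ∘ suc) k

      -- Writes the product from the first recursive call over the longer range, so that it shares
      -- the factor `∏< (suc n) w` with the shifted call.
      ∏<-init : ∀ n b w → Inverse (suc n) b w → ∏< n w ≈ ∏< (suc n) w * ((m + b + 1# + ↑ n) * (m + b + 1# + ↑ n))
      ∏<-init n b w inv = sym (begin
        ∏< (suc n) w * (q * q)    ≈⟨ *-congʳ (∏<-last n w) ⟩
        ∏< n w * w n * (q * q)    ≈⟨ solve 3 (λ W w q → W :* w :* (q :* q) := W :* (q :* q :* w)) refl (∏< n w) (w n) q ⟩
        ∏< n w * (q * q * w n)    ≈⟨ *-congˡ (inv n (ℕₚ.n<1+n n)) ⟩
        ∏< n w * 1#               ≈⟨ *-identityʳ (∏< n w) ⟩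
        ∏< n w                    ∎)
        where
        q : Carrier
        q = m + b + 1# + ↑ n

      ∑<-init : ∀ n w → ∑< n w ≈ ∑< (suc n) w - w n
      ∑<-init n w = sym (trans (+-congʳ (∑<-last n w)) (solve 2 (λ h w → h :+ w :- w := h) refl (∑< n w) (w n)))

      P-suc : ∀ n → P (suc n) ≈ rising m n * (m + ↑ n) * (rising m n * (m + ↑ n))
      P-suc n = *-cong (∏<-last n (λ j → m + ↑ j)) (∏<-last n (λ j → m + ↑ j))

      parameter-suc : ∀ {b c} → c ≈ m + m + b → c + 1# ≈ m + m + (b + 1#)
      parameter-suc {b} c≈ = trans (+-congʳ c≈) (+-assoc (m + m) b 1#)

      -- Induction on n for all b, c and w at once. Both recursive calls have the same `m`, hence
      -- the same `P n`, and the step reduces to the polynomial identity Z(n, b) (m + b + 1 + n)² -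
      -- (2n + 2m + b + 1) b Z(n, b + 1) = Z(n + 1, b) (m + n)².
      ⟨⟩-term : ∀ n c b w → c ≈ m + m + b → Inverse n b w → ⟨ n , c ⟩ (term b w) ≈ e * Z n b * (P n * ∏< n w)
      ⟨⟩-term zero c b w c≈ inv = begin
        ⟨ 0 , c ⟩ (term b w)
          ≈⟨ solve 1 (λ i → con (+ 1) :* (con (+ 1) :* i) :* con (+ 1) :* (con (+ 1) :* con (+ 1)) :+ con (+ 0) := i) refl (invFact 0) ⟩
        invFact 0     ≈⟨ invFact-zero ⟩
        1#            ≈⟨ em²≈1 ⟨
        e * (m * m)
          ≈⟨ solve 3 (λ e m b → e :* (m :* m) := e :* (m :* m :+ con (+ 0) :* (con (+ 0) :+ (m :+ m :+ b))) :* (con (+ 1) :* con (+ 1) :* con (+ 1)))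
               refl e m b ⟩
        e * Z 0 b * (P 0 * 1#) ∎
      ⟨⟩-term (suc n) c b w c≈ inv = begin
        ⟨ suc n , c ⟩ (term b w)
          ≈⟨ ⟨⟩-suc n c (term b w) ⟩
        ⟨ n , c ⟩ (term b w) - (ν + ν + c + 1#) * ⟨ n , c + 1# ⟩ (term b w ∘ suc)
          ≈⟨ +-cong (⟨⟩-term n c b w c≈ (inverse-init inv))
               (-‿cong (*-cong (+-congʳ (+-congˡ c≈)) (trans (⟨⟩-term-suc n (c + 1#) b w)
                 (*-congˡ (⟨⟩-term n (c + 1#) (b + 1#) (w ∘ suc) (parameter-suc c≈) (inverse-tail inv)))))) ⟩
        e * Z n b * (P n * ∏< n w) - (ν + ν + (m + m + b) + 1#) * (b * w 0 * (e * Z n (b + 1#) * (P n * W)))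
          ≈⟨ +-congʳ (*-congˡ (*-congˡ (∏<-init n b w inv))) ⟩
        e * Z n b * (P n * (w 0 * W * (q * q))) - (ν + ν + (m + m + b) + 1#) * (b * w 0 * (e * Z n (b + 1#) * (P n * W)))
          ≈⟨ solve 7 (λ e m b ν R w₀ W →
               let 1' = con (+ 1)
                   Z = λ ν b → m :* m :+ ν :* (ν :+ (m :+ m :+ b))
                   q = m :+ b :+ 1' :+ ν
               in e :* Z ν b :* (R :* R :* (w₀ :* W :* (q :* q)))
                    :- (ν :+ ν :+ (m :+ m :+ b) :+ 1') :* (b :* w₀ :* (e :* Z ν (b :+ 1') :* (R :* R :* W)))
                  := e :* Z (1' :+ ν) b :* (R :* (m :+ ν) :* (R :* (m :+ ν)) :* (w₀ :* W)))
               refl e m b ν (rising m n) (w 0) W ⟩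
        e * Z (suc n) b * (rising m n * (m + ν) * (rising m n * (m + ν)) * ∏< (suc n) w)
          ≈⟨ *-congˡ (*-congʳ (P-suc n)) ⟨
        e * Z (suc n) b * (P (suc n) * ∏< (suc n) w) ∎
        where
        ν q W : Carrier
        ν = ↑ n
        q = m + b + 1# + ν
        W = ∏< n (w ∘ suc)

      -- The right side is the ε²-coefficient of (1 + N / (m² - ε²)) (m + ε)ₙ (m - ε)ₙ / ∏ ((x + 1 +
      -- j)² - ε²): the first factor is e Z + e² N ε² + ..., the rising factorials contribute minus
      -- the sum of `r⁻¹` and the denominator plus the sum of `w`. The shifted call moves `w` but
      -- not `r⁻¹`, since `m` stays fixed.
      ⟨⟩-termH : ∀ n c b w → c ≈ m + m + b → Inverse n b w → (∀ j → j < n → (m + ↑ j) * (m + ↑ j) * r⁻¹ j ≈ 1#) →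
                 ⟨ n , c ⟩ (termH b w) ≈ e * Z n b * (P n * ∏< n w) * (∑< n w - ∑< n r⁻¹) + e * e * N n b * (P n * ∏< n w)
      ⟨⟩-termH zero c b w c≈ inv r-inv =
        solve 4 (λ i e m b → let 0' = con (+ 0) ; 1' = con (+ 1) ; N = 0' :* (0' :+ (m :+ m :+ b)) in
            1' :* (1' :* i) :* 1' :* (1' :* 1' :* 0') :+ 0'
            := e :* (m :* m :+ N) :* (1' :* 1' :* 1') :* (0' :- 0') :+ e :* e :* N :* (1' :* 1' :* 1'))
          refl (invFact 0) e m b
      ⟨⟩-termH (suc n) c b w c≈ inv r-inv = begin
        ⟨ suc n , c ⟩ (termH b w)
          ≈⟨ ⟨⟩-suc n c (termH b w) ⟩
        ⟨ n , c ⟩ (termH b w) - (ν + ν + c + 1#) * ⟨ n , c + 1# ⟩ (termH b w ∘ suc)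
          ≈⟨ +-cong (⟨⟩-termH n c b w c≈ (inverse-init inv) r-inv-init)
               (-‿cong (*-cong (+-congʳ (+-congˡ c≈)) (trans (⟨⟩-termH-suc n (c + 1#) b w) (*-congˡ (+-cong
                 (*-congˡ (⟨⟩-term n (c + 1#) (b + 1#) (w ∘ suc) (parameter-suc c≈) (inverse-tail inv)))
                 (⟨⟩-termH n (c + 1#) (b + 1#) (w ∘ suc) (parameter-suc c≈) (inverse-tail inv) r-inv-init)))))) ⟩
        e * Z n b * (P n * ∏< n w) * (∑< n w - g) + e * e * N n b * (P n * ∏< n w) - X
          ≈⟨ +-congʳ (+-cong (*-cong (*-congˡ (*-congˡ (∏<-init n b w inv))) (+-congʳ (∑<-init n w)))
                             (*-congˡ (*-congˡ (∏<-init n b w inv)))) ⟩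
        -- The two sides differ by a combination of (m + ν)² ρ - 1, q² wₙ - 1 and e m² - 1, which all vanish.
        e * Z n b * (P n * (w₀ * W * (q * q))) * (w₀ + h - w n - g) + e * e * N n b * (P n * (w₀ * W * (q * q))) - X
          ≈⟨ solve 11 (λ e m b ν R w₀ W h w g ρ →
               let 1' = con (+ 1)
                   N = λ ν b → ν :* (ν :+ (m :+ m :+ b))
                   Z = λ ν b → m :* m :+ N ν b
                   b' = b :+ 1'
                   ν' = 1' :+ ν
                   q = m :+ b :+ 1' :+ ν
                   R' = R :* (m :+ ν)
                   closed = λ ν b RR W d → e :* Z ν b :* (RR :* W) :* d :+ e :* e :* N ν b :* (RR :* W)
               in closed ν b (R :* R) (w₀ :* W :* (q :* q)) ((w₀ :+ h :- w) :- g)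
                    :- (ν :+ ν :+ (m :+ m :+ b) :+ 1') :* (b :* w₀ :* (w₀ :* (e :* Z ν b' :* (R :* R :* W)) :+ closed ν b' (R :* R) W (h :- g)))
                  := closed ν' b (R' :* R') (w₀ :* W) ((w₀ :+ h) :- (g :+ ρ))
                    :+ R :* R :* (w₀ :* W) :* (e :* Z ν' b :* ((m :+ ν) :* (m :+ ν) :* ρ :- 1')
                      :- e :* Z ν b :* (q :* q :* w :- 1')
                      :+ e :* (N ν b :- N ν' b) :* (e :* (m :* m) :- 1')))
             refl e m b ν R₀ w₀ W h (w n) g ρ ⟩
        Y + R₀ * R₀ * ∏< (suc n) w * (e * Z (suc n) b * ((m + ν) * (m + ν) * ρ - 1#) - e * Z n b * (q * q * w n - 1#)
              + e * (N n b - N (suc n) b) * (e * (m * m) - 1#))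
          ≈⟨ +-congˡ (*-congˡ (+-cong (+-cong (*-congˡ (-1≈0 (r-inv n (ℕₚ.n<1+n n)))) (-‿cong (*-congˡ (-1≈0 (inv n (ℕₚ.n<1+n n)))))) (*-congˡ (-1≈0 em²≈1)))) ⟩
        Y + R₀ * R₀ * ∏< (suc n) w * (e * Z (suc n) b * 0# - e * Z n b * 0# + e * (N n b - N (suc n) b) * 0#)
          ≈⟨ solve 5 (λ Y A B C D → Y :+ A :* (B :* con (+ 0) :- C :* con (+ 0) :+ D :* con (+ 0)) := Y) refl Y _ _ _ _ ⟩
        Y
          ≈⟨ +-cong (*-cong (*-congˡ (*-congʳ (P-suc n))) (+-congˡ (-‿cong (∑<-last n r⁻¹)))) (*-congˡ (*-congʳ (P-suc n))) ⟨
        e * Z (suc n) b * (P (suc n) * ∏< (suc n) w) * (∑< (suc n) w - ∑< (suc n) r⁻¹) + e * e * N (suc n) b * (P (suc n) * ∏< (suc n) w) ∎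
        where
        ν q R₀ w₀ W h g ρ X Y : Carrier
        ν = ↑ n
        q = m + b + 1# + ν
        R₀ = rising m n
        w₀ = w 0
        W = ∏< n (w ∘ suc)
        h = ∑< n (w ∘ suc)
        g = ∑< n r⁻¹
        ρ = r⁻¹ n
        X = (ν + ν + (m + m + b) + 1#) * (b * w₀ * (w₀ * (e * Z n (b + 1#) * (P n * W))
              + (e * Z n (b + 1#) * (P n * W) * (h - g) + e * e * N n (b + 1#) * (P n * W))))
        Y = e * Z (suc n) b * (R₀ * (m + ν) * (R₀ * (m + ν)) * ∏< (suc n) w) * (∑< (suc n) w - (g + ρ))
              + e * e * N (suc n) b * (R₀ * (m + ν) * (R₀ * (m + ν)) * ∏< (suc n) w)
        r-inv-init : ∀ j → j < n → (m + ↑ j) * (m + ↑ j) * r⁻¹ j ≈ 1#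
        r-inv-init j j<n = r-inv j (ℕₚ.m<n⇒m<1+n j<n)
        -1≈0 : ∀ {x} → x ≈ 1# → x - 1# ≈ 0#
        -1≈0 x≈1 = trans (+-congʳ x≈1) (-‿inverseʳ 1#)

-- Reciprocals in the complex field

open import Defs

ℂ-commutativeRing : CommutativeRing _ _
ℂ-commutativeRing = toCommutativeRing ℂ-heytingField

open HeytingField ℂ-heytingField using (#⇒invertible)
open FieldNotation ℂ-heytingField ℂ-characteristicZero using (k!#0; +↑#0)
open CommutativeRing ℂ-commutativeRing
  using (setoid; semiring; +-monoid; refl; sym; trans; +-cong; +-congˡ; +-congʳ; +-assoc; +-comm; +-identityʳ;
         *-cong; *-congˡ; *-congʳ; *-assoc; *-comm; *-identityˡ; *-identityʳ; -‿cong)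
open import Algebra.Apartness.Properties.HeytingCommutativeRing (HeytingField.heytingCommutativeRing ℂ-heytingField) using (x-0≈x)
open import Algebra.Properties.Monoid.Sum +-monoid using (sum; sum-cong-≋)
open import Algebra.Properties.Semiring.Mult semiring using (×1-homo-*)
open import Relation.Binary.Reasoning.Setoid setoid
open IntegerCoefficientSolver ℂ-commutativeRing using (solve; _:=_; _:+_; _:-_; _:*_; con)

inverse : ∀ {d} → d # 0# → ℂ
inverse d#0 = proj₁ (#⇒invertible d#0)

*-inverse : ∀ {d} (d#0 : d # 0#) → d * inverse d#0 ≈ 1#
*-inverse {d} d#0 = trans (*-congʳ (sym (x-0≈x d))) (proj₂ (proj₂ (#⇒invertible d#0)))

-- Every quotient carries the inverse extracted from its own apartness proof; this makes the choice
-- of proof irrelevant up to `_≈_`.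
inverse-unique : ∀ {d u v} → d * u ≈ 1# → d * v ≈ 1# → u ≈ v
inverse-unique {d} {u} {v} du≈1 dv≈1 = begin
  u           ≈⟨ *-identityʳ u ⟨
  u * 1#      ≈⟨ *-congˡ dv≈1 ⟨
  u * (d * v) ≈⟨ solve 3 (λ u d v → u :* (d :* v) := d :* u :* v) refl u d v ⟩
  d * u * v   ≈⟨ *-congʳ du≈1 ⟩
  1# * v      ≈⟨ *-identityˡ v ⟩
  v           ∎

-- The junk value 0 is taken from index n on.
inverses : ∀ n (d : ℕ → ℂ) → (∀ j → j < n → d j # 0#) → Σ[ w ∈ (ℕ → ℂ) ] ∀ j → j < n → d j * w j ≈ 1#
inverses zero    d d#0 = (λ _ → 0#) , λ _ ()
inverses (suc n) d d#0 with inverses n (d ∘ suc) (λ j j<n → d#0 (suc j) (s≤s j<n))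
... | w , dw≈1 = (λ { zero → inverse (d#0 0 (s≤s z≤n)) ; (suc j) → w j })
               , (λ { zero _ → *-inverse (d#0 0 (s≤s z≤n)) ; (suc j) (s≤s j<n) → dw≈1 j j<n })

-- The closed forms take sequences on all of ℕ, whereas `u∉` permits division only at indices below
-- n.
inverse-squares : ∀ n u → u ∉-[1‥ n ] → Σ[ w ∈ (ℕ → ℂ) ] ∀ j → j < n → (u + ↑ suc j) ^ 2 * w j ≈ 1#
inverse-squares n u u∉ = inverses n (λ j → (u + ↑ suc j) ^ 2) (λ j j<n → ^#0 2 (+↑#0 (suc j) (u∉ (suc j) (s≤s z≤n) j<n)))

invFact : ℕ → ℂ
invFact k = inverse (k!#0 k)

*-invFact : ∀ k → ↑ (k !) * invFact k ≈ 1#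
*-invFact k = *-inverse (k!#0 k)

invFact-zero : invFact 0 ≈ 1#
invFact-zero = inverse-unique (*-invFact 0) (trans (*-identityʳ (↑ 1)) (+-identityʳ 1#))

invFact-suc : ∀ k → ↑ suc k * invFact (suc k) ≈ invFact k
invFact-suc k = inverse-unique (begin
  ↑ (k !) * (↑ suc k * invFact (suc k))
    ≈⟨ solve 3 (λ a b c → a :* (b :* c) := b :* a :* c) refl (↑ (k !)) (↑ suc k) (invFact (suc k)) ⟩
  ↑ suc k * ↑ (k !) * invFact (suc k)
    ≈⟨ *-congʳ (×1-homo-* (suc k) (k !)) ⟨
  ↑ (suc k !) * invFact (suc k)
    ≈⟨ *-invFact (suc k) ⟩
  1# ∎) (*-invFact k)

-- Translation of binomials and harmonic numbers

open HypergeometricSum ℂ-commutativeRing invFact hiding (↑_)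

falling-cong : ∀ {u v} → u ≈ v → ∀ k → falling u k ≈ falling v k
falling-cong u≈v k = ∏<-cong k (λ j _ → +-congʳ { - ↑ j} u≈v)

-- The same product u + 1, ..., u + k in opposite order: the first factor of the falling product is
-- the last one of the rising product.
falling≈rising : ∀ u k → falling (u + ↑ k) k ≈ rising (1# + u) k
falling≈rising u zero    = refl
falling≈rising u (suc k) = begin
  falling (u + (1# + ↑ k)) (suc k)
    ≈⟨ falling-cong (solve 2 (λ u k → u :+ (con (+ 1) :+ k) := con (+ 1) :+ (u :+ k)) refl u (↑ k)) (suc k) ⟩
  falling (1# + (u + ↑ k)) (suc k)
    ≈⟨ falling-head (u + ↑ k) k ⟩
  (1# + (u + ↑ k)) * falling (u + ↑ k) k
    ≈⟨ *-cong (sym (+-assoc 1# u (↑ k))) (falling≈rising u k) ⟩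
  (1# + u + ↑ k) * rising (1# + u) k
    ≈⟨ *-comm (1# + u + ↑ k) (rising (1# + u) k) ⟩
  rising (1# + u) k * (1# + u + ↑ k)
    ≈⟨ ∏<-last k (λ j → 1# + u + ↑ j) ⟨
  rising (1# + u) (suc k) ∎

binom-rising : ∀ u k → binom (u + ↑ k) k ≈ rising (1# + u) k * invFact k
binom-rising u k = *-congʳ (falling≈rising u k)

∏<-inverse-squares : ∀ k (d w : ℕ → ℂ) → (∀ j → j < k → d j ^ 2 * w j ≈ 1#) → ∏< k d ^ 2 * ∏< k w ≈ 1#
∏<-inverse-squares zero    d w dw≈1 = solve 0 (con (+ 1) :* (con (+ 1) :* con (+ 1)) :* con (+ 1) := con (+ 1)) refl
∏<-inverse-squares (suc k) d w dw≈1 = begin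
  (d 0 * D) ^ 2 * (w 0 * W)
    ≈⟨ solve 4 (λ d D w W → d :* D :* (d :* D :* con (+ 1)) :* (w :* W) := d :* (d :* con (+ 1)) :* w :* (D :* (D :* con (+ 1)) :* W))
         refl (d 0) D (w 0) W ⟩
  d 0 ^ 2 * w 0 * (D ^ 2 * W)
    ≈⟨ *-cong (dw≈1 0 (s≤s z≤n)) (∏<-inverse-squares k (d ∘ suc) (w ∘ suc) (λ j j<k → dw≈1 (suc j) (s≤s j<k))) ⟩
  1# * 1#
    ≈⟨ *-identityˡ 1# ⟩
  1# ∎
  where
  D W : ℂ
  D = ∏< k (d ∘ suc)
  W = ∏< k (w ∘ suc)

^2-cong : ∀ {u v} → u ≈ v → u ^ 2 ≈ v ^ 2
^2-cong u≈v = *-cong u≈v (*-congʳ u≈v)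

module _ {k u} (w : ℕ → ℂ) (uw≈1 : ∀ j → j < k → (u + ↑ suc j) ^ 2 * w j ≈ 1#) where

  -- Leaving `p` arbitrary makes this apply to whichever apartness proofs a harmonic number was
  -- built from.
  H-∑< : {p : ∀ (i : Fin k) → (u + ↑ suc (toℕ i)) ^ 2 # 0#} → sum {k} (λ i → 1# / (u + ↑ suc (toℕ i)) ^ 2 [ p i ]) ≈ ∑< k w
  H-∑< = sum-cong-≋ {k} λ i → trans (*-identityˡ _)
    (inverse-unique (*-inverse _) (uw≈1 (toℕ i) (Finₚ.toℕ<n i)))

  -- The binomial is (u + 1)ₖ / k!, and `∏< k w` inverts the square of (u + 1)ₖ.
  inverse-binom² : (p : binom (u + ↑ k) k ^ 2 # 0#) → inverse p ≈ ↑ (k !) ^ 2 * ∏< k w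
  inverse-binom² p = inverse-unique (*-inverse p) (begin
    binom (u + ↑ k) k ^ 2 * (↑ (k !) ^ 2 * ∏< k w)
      ≈⟨ *-congʳ (^2-cong (trans (binom-rising u k) (*-congʳ (∏<-cong k (λ j _ → shift j))))) ⟩
    (D * invFact k) ^ 2 * (↑ (k !) ^ 2 * ∏< k w)
      ≈⟨ solve 4 (λ D i f W → D :* i :* (D :* i :* con (+ 1)) :* (f :* (f :* con (+ 1)) :* W)
             := f :* i :* (f :* i :* con (+ 1)) :* (D :* (D :* con (+ 1)) :* W)) refl D (invFact k) (↑ (k !)) (∏< k w) ⟩
    (↑ (k !) * invFact k) ^ 2 * (D ^ 2 * ∏< k w)
      ≈⟨ *-cong (^2-cong (*-invFact k)) (∏<-inverse-squares k (λ j → u + ↑ suc j) w uw≈1) ⟩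
    1# ^ 2 * 1#
      ≈⟨ solve 0 (con (+ 1) :* (con (+ 1) :* con (+ 1)) :* con (+ 1) := con (+ 1)) refl ⟩
    1# ∎)
    where
    D : ℂ
    D = ∏< k (λ j → u + ↑ suc j)
    shift : ∀ j → 1# + u + ↑ j ≈ u + ↑ suc j
    shift j = solve 2 (λ u j → con (+ 1) :+ u :+ j := u :+ (con (+ 1) :+ j)) refl u (↑ j)

-- Instantiating a statement about an arbitrary x∉ with ∉-mono k≤n x∉ makes the conversion checker
-- unfold the apartness proofs, so this instance is stated by itself.
H-mono-∑< : ∀ {n k x} (w : ℕ → ℂ) (xw≈1 : ∀ j → j < k → (x + ↑ suc j) ^ 2 * w j ≈ 1#) (k≤n : k ≤ n) (x∉ : x ∉-[1‥ n ]) →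
            H⟨ 2 ⟩ k x (∉-mono k≤n x∉) ≈ ∑< k w
H-mono-∑< w xw≈1 k≤n x∉ = H-∑< w xw≈1

-- Both (y - 1) y (y + 1)ₖ and (y - 1)ₖ (y + k - 1)(y + k) are (y - 1)ₖ₊₂.
rising-pred : ∀ y k (p : (y + ↑ k - 1#) * (y + ↑ k) # 0#) →
              rising (1# + y) k * ((y - 1#) * y * inverse p) ≈ rising (y - 1#) k
rising-pred y k p = begin
  rising (1# + y) k * ((y - 1#) * y * inverse p)
    ≈⟨ solve 3 (λ r y i → r :* ((y :- con (+ 1)) :* y :* i) := (y :- con (+ 1)) :* (y :* r) :* i) refl (rising (1# + y) k) y (inverse p) ⟩
  (y - 1#) * (y * rising (1# + y) k) * inverse p
    ≈⟨ *-congʳ (begin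
        (y - 1#) * (y * rising (1# + y) k)
          ≈⟨ *-congˡ (*-congˡ (rising-cong (+-comm 1# y) k)) ⟩
        (y - 1#) * (y * rising (y + 1#) k)
          ≈⟨ *-congˡ (rising-head y k) ⟨
        (y - 1#) * rising y (suc k)
          ≈⟨ *-congˡ (rising-cong (solve 1 (λ y → y := y :- con (+ 1) :+ con (+ 1)) refl y) (suc k)) ⟩
        (y - 1#) * rising (y - 1# + 1#) (suc k)
          ≈⟨ rising-head (y - 1#) (suc k) ⟨
        rising (y - 1#) (suc (suc k))
          ≈⟨ trans (∏<-last (suc k) (λ j → y - 1# + ↑ j)) (*-congʳ (∏<-last k (λ j → y - 1# + ↑ j))) ⟩
        rising (y - 1#) k * (y - 1# + ↑ k) * (y - 1# + ↑ suc k)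
          ≈⟨ solve 3 (λ r y k → r :* (y :- con (+ 1) :+ k) :* (y :- con (+ 1) :+ (con (+ 1) :+ k))
                := r :* ((y :+ k :- con (+ 1)) :* (y :+ k))) refl (rising (y - 1#) k) y (↑ k) ⟩
        rising (y - 1#) k * ((y + ↑ k - 1#) * (y + ↑ k)) ∎) ⟩
  rising (y - 1#) k * ((y + ↑ k - 1#) * (y + ↑ k)) * inverse p
    ≈⟨ *-assoc (rising (y - 1#) k) _ (inverse p) ⟩
  rising (y - 1#) k * ((y + ↑ k - 1#) * (y + ↑ k) * inverse p)
    ≈⟨ *-congˡ (*-inverse p) ⟩
  rising (y - 1#) k * 1#
    ≈⟨ *-identityʳ (rising (y - 1#) k) ⟩
  rising (y - 1#) k ∎

-- The factors 1 / k! of the two numerator binomials cancel the k!² coming from the squared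
-- denominator.
regroup : ∀ C A B Y W h {f F R} → F * f ≈ 1# → B * Y ≈ R →
  C * ((A * f * (B * f)) * (F ^ 2 * W)) * Y * h ≈ C * A * (R * W * h)
regroup C A B Y W h {f} {F} {R} Ff≈1 BY≈R = begin
  C * ((A * f * (B * f)) * (F ^ 2 * W)) * Y * h
    ≈⟨ solve 8 (λ C A B Y W h f F → C :* ((A :* f :* (B :* f)) :* (F :* (F :* con (+ 1)) :* W)) :* Y :* h
           := C :* A :* (B :* Y :* W :* h) :* (F :* f :* (F :* f :* con (+ 1)))) refl C A B Y W h f F ⟩
  C * A * (B * Y * W * h) * (F * f) ^ 2
    ≈⟨ *-cong (*-congˡ (*-congʳ (*-congʳ BY≈R))) (^2-cong Ff≈1) ⟩
  C * A * (R * W * h) * 1# ^ 2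
    ≈⟨ solve 1 (λ t → t :* (con (+ 1) :* (con (+ 1) :* con (+ 1))) := t) refl _ ⟩
  C * A * (R * W * h) ∎

summand : ∀ n {x y} (w : ℕ → ℂ) (xw≈1 : ∀ j → j < n → (x + ↑ suc j) ^ 2 * w j ≈ 1#)
  (x∉ : x ∉-[1‥ n ]) (y#1 : y # 1#) (y∉ : y ∉-[0‥ n ]) k (k≤n : k ≤ n) →
    (- 1#) ^ k * binom (↑ n) k
    * ((binom (↑ 2 * x - y + ↑ n + ↑ k) k * binom (y + ↑ k) k)
        / binom (x + ↑ k) k ^ 2 [ ^#0 2 (binom#0 k (∉-mono k≤n x∉)) ])
    * (((y - 1#) * y) / (y + ↑ k - 1#) * (y + ↑ k) [ [y+k-1][y+k]#0 k y#1 y∉ k≤n ])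
    * H⟨ 2 ⟩ k x (∉-mono k≤n x∉)
    ≈ coef (↑ n) (↑ n + (1# + ↑ 2 * x - y)) k * termH (y - 1#) w k
summand n {x} {y} w xw≈1 x∉ y#1 y∉ k k≤n = trans
  (*-cong (*-congʳ (*-congˡ (*-cong (*-cong 2x-y≈ (binom-rising y k)) (inverse-binom² w xw≈1′ _))))
          (H-mono-∑< w xw≈1′ k≤n x∉))
  -- `C` is `(- 1#) ^ k * binom (↑ n) k`, which unfolds to the leading factor of `coef`; its 1 / k!
  -- is the only factorial that survives.
  (regroup _ _ _ _ _ _ (*-invFact k) (rising-pred y k _))
  where
  xw≈1′ : ∀ j → j < k → (x + ↑ suc j) ^ 2 * w j ≈ 1#
  xw≈1′ j j<k = xw≈1 j (ℕₚ.<-≤-trans j<k k≤n)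
  2x-y≈ : binom (↑ 2 * x - y + ↑ n + ↑ k) k ≈ rising (↑ n + (1# + ↑ 2 * x - y)) k * invFact k
  2x-y≈ = trans (binom-rising (↑ 2 * x - y + ↑ n) k) (*-congʳ (rising-cong
    (solve 3 (λ t y n → con (+ 1) :+ (t :- y :+ n) := n :+ (con (+ 1) :+ t :- y)) refl (↑ 2 * x) y (↑ n)) k))

binom²-ratio : ∀ n {u x} (w : ℕ → ℂ) (xw≈1 : ∀ j → j < n → (x + ↑ suc j) ^ 2 * w j ≈ 1#) (p : binom (x + ↑ n) n ^ 2 # 0#) →
  binom (u + ↑ n) n ^ 2 / binom (x + ↑ n) n ^ 2 [ p ] ≈ rising (1# + u) n * rising (1# + u) n * ∏< n w
binom²-ratio n {u} w xw≈1 p = begin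
  binom (u + ↑ n) n ^ 2 * inverse p
    ≈⟨ *-cong (^2-cong (binom-rising u n)) (inverse-binom² w xw≈1 p) ⟩
  (rising (1# + u) n * invFact n) ^ 2 * (↑ (n !) ^ 2 * ∏< n w)
    ≈⟨ solve 4 (λ r f F W → r :* f :* (r :* f :* con (+ 1)) :* (F :* (F :* con (+ 1)) :* W)
           := r :* r :* W :* (F :* f :* (F :* f :* con (+ 1)))) refl (rising (1# + u) n) (invFact n) (↑ (n !)) (∏< n w) ⟩
  rising (1# + u) n * rising (1# + u) n * ∏< n w * (↑ (n !) * invFact n) ^ 2
    ≈⟨ *-congˡ (^2-cong (*-invFact n)) ⟩
  rising (1# + u) n * rising (1# + u) n * ∏< n w * 1# ^ 2
    ≈⟨ solve 1 (λ t → t :* (con (+ 1) :* (con (+ 1) :* con (+ 1))) := t) refl _ ⟩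
  rising (1# + u) n * rising (1# + u) n * ∏< n w ∎

square-+-product : ∀ {u v w} → v ≈ w → u ^ 2 + u * v ≈ u * (u + w)
square-+-product {u} {v} {w} v≈w = trans (+-congˡ (*-congˡ v≈w))
  (solve 2 (λ u w → u :* (u :* con (+ 1)) :+ u :* w := u :* (u :+ w)) refl u w)

inverse-^4 : ∀ {u v} → v * (u * u) ≈ 1# → (p : u ^ 4 # 0#) → inverse p ≈ v * v
inverse-^4 {u} {v} vu²≈1 p = inverse-unique (*-inverse p) (begin
  u ^ 4 * (v * v)
    ≈⟨ solve 2 (λ u v → u :* (u :* (u :* (u :* con (+ 1)))) :* (v :* v) := v :* (u :* u) :* (v :* (u :* u))) refl u v ⟩
  v * (u * u) * (v * (u * u))
    ≈⟨ *-cong vu²≈1 vu²≈1 ⟩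
  1# * 1#
    ≈⟨ *-identityˡ 1# ⟩
  1# ∎)

-- Specialisation of the closed form and the theorem

closed-form : ∀ n {x y} (w r⁻¹ : ℕ → ℂ) →
  (∀ j → j < n → (x + ↑ suc j) ^ 2 * w j ≈ 1#) → (∀ j → j < n → (x - y + ↑ suc j) ^ 2 * r⁻¹ j ≈ 1#) →
  (x∉ : x ∉-[1‥ n ]) (x-y∉ : x - y ∉-[1‥ n ])
  (p : binom (x + ↑ n) n ^ 2 # 0#) (q₂ : (1# + x - y) ^ 2 # 0#) (q₄ : (1# + x - y) ^ 4 # 0#) →
  ⟨ n , 1# + ↑ 2 * x - y ⟩ (termH (y - 1#) w)
  ≈ ((↑ n ^ 2 + ↑ n * (1# + ↑ 2 * x - y) + (1# + x - y) ^ 2) / (1# + x - y) ^ 2 [ q₂ ])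
  * (binom (x - y + ↑ n) n ^ 2 / binom (x + ↑ n) n ^ 2 [ p ])
  * (H⟨ 2 ⟩ n x x∉ - H⟨ 2 ⟩ n (x - y) x-y∉)
  + ((↑ n ^ 2 + ↑ n * (1# + ↑ 2 * x - y)) / (1# + x - y) ^ 4 [ q₄ ])
  * (binom (x - y + ↑ n) n ^ 2 / binom (x + ↑ n) n ^ 2 [ p ])
closed-form n {x} {y} w r⁻¹ xw≈1 x-yr≈1 x∉ x-y∉ p q₂ q₄ = trans
  (⟨⟩-termH n c b w c≈ w-inverse r-inverse)
  (sym (+-cong (*-cong (*-cong Z≈ ratio≈) (+-cong (H-∑< w xw≈1) (-‿cong (H-∑< r⁻¹ x-yr≈1))))
               (*-cong N≈ ratio≈)))
  where
  m b c e : ℂ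
  m = 1# + x - y
  b = y - 1#
  c = 1# + ↑ 2 * x - y
  -- Taking the very inverse that `q₂` provides makes the quotient by (1 + x - y)² a product with
  -- `e` by definition; the fourth power then yields `e * e` by uniqueness of inverses.
  e = inverse q₂

  em²≈1 : e * (m * m) ≈ 1#
  em²≈1 = trans (solve 2 (λ e m → e :* (m :* m) := m :* (m :* con (+ 1)) :* e) refl e m) (*-inverse q₂)

  open ClosedForm invFact-zero invFact-suc m e r⁻¹ em²≈1

  c≈ : c ≈ m + m + b
  c≈ = solve 2 (λ x y → let 1' = con (+ 1) in
         -- The factor of `x` spells out `↑ 2` as it unfolds, with its trailing zero.
         1' :+ (1' :+ (1' :+ con (+ 0))) :* x :- y := (1' :+ x :- y) :+ (1' :+ x :- y) :+ (y :- 1')) refl x y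

  -- As m + b = x, the base m + b + 1 + j is x + (j + 1).
  w-inverse : Inverse n b w
  w-inverse j j<n = trans (*-congʳ (solve 3 (λ x y j →
    let 1' = con (+ 1)
        d  = (1' :+ x :- y) :+ (y :- 1') :+ 1' :+ j
        d' = x :+ (1' :+ j)
    in d :* d := d' :* (d' :* 1')) refl x y (↑ j))) (xw≈1 j j<n)

  r-inverse : ∀ j → j < n → (m + ↑ j) * (m + ↑ j) * r⁻¹ j ≈ 1#
  r-inverse j j<n = trans (*-congʳ (solve 3 (λ x y j →
    let 1' = con (+ 1)
        d  = (1' :+ x :- y) :+ j
        d' = x :- y :+ (1' :+ j)
    in d :* d := d' :* (d' :* 1')) refl x y (↑ j))) (x-yr≈1 j j<n)

  N′≈ : ↑ n ^ 2 + ↑ n * c ≈ N n b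
  N′≈ = square-+-product c≈

  Z≈ : (↑ n ^ 2 + ↑ n * c + m ^ 2) * e ≈ e * Z n b
  Z≈ = trans (*-comm (↑ n ^ 2 + ↑ n * c + m ^ 2) e)
    (*-congˡ (trans (+-comm (↑ n ^ 2 + ↑ n * c) (m ^ 2)) (+-cong (*-congˡ (*-identityʳ m)) N′≈)))

  N≈ : (↑ n ^ 2 + ↑ n * c) * inverse q₄ ≈ e * e * N n b
  N≈ = trans (*-cong N′≈ (inverse-^4 em²≈1 q₄)) (*-comm (N n b) (e * e))

  ratio≈ : binom (x - y + ↑ n) n ^ 2 * inverse p ≈ P n * ∏< n w
  ratio≈ = trans (binom²-ratio n {x - y} w xw≈1 p) (*-congʳ (*-cong rising≈ rising≈))
    where
    rising≈ : rising (1# + (x - y)) n ≈ rising m n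
    rising≈ = rising-cong (sym (+-assoc 1# x (- y))) n

theorem4 : ∀ (n : ℕ) (x y : ℂ)
    (x∉ : x ∉-[1‥ n ]) (x-y∉ : x - y ∉-[1‥ n ]) (1+x-y#0 : 1# + x - y # 0#)
    (y#1 : y # 1#) (y∉ : y ∉-[0‥ n ]) →
    ∑[0‥ n ] (λ k k≤n →
    (- 1#) ^ k * binom (↑ n) k
    * ((binom (↑ 2 * x - y + ↑ n + ↑ k) k * binom (y + ↑ k) k)
    / binom (x + ↑ k) k ^ 2 [ ^#0 2 (binom#0 k (∉-mono k≤n x∉)) ])
    * (((y - 1#) * y) / (y + ↑ k - 1#) * (y + ↑ k) [ [y+k-1][y+k]#0 k y#1 y∉ k≤n ])
    * H⟨ 2 ⟩ k x (∉-mono k≤n x∉))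
    ≈ ((↑ n ^ 2 + ↑ n * (1# + ↑ 2 * x - y) + (1# + x - y) ^ 2) / (1# + x - y) ^ 2 [ ^#0 2 1+x-y#0 ])
    * (binom (x - y + ↑ n) n ^ 2 / binom (x + ↑ n) n ^ 2 [ ^#0 2 (binom#0 n x∉) ])
    * (H⟨ 2 ⟩ n x x∉ - H⟨ 2 ⟩ n (x - y) x-y∉)
    + ((↑ n ^ 2 + ↑ n * (1# + ↑ 2 * x - y)) / (1# + x - y) ^ 4 [ ^#0 4 1+x-y#0 ])
    * (binom (x - y + ↑ n) n ^ 2 / binom (x + ↑ n) n ^ 2 [ ^#0 2 (binom#0 n x∉) ])
theorem4 n x y x∉ x-y∉ 1+x-y#0 y#1 y∉ = trans
  (sum-cong-≋ {suc n} λ i → summand n w xw≈1 x∉ y#1 y∉ (toℕ i) (Finₚ.toℕ≤pred[n] i))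
  (closed-form n w r⁻¹ xw≈1 x-yr≈1 x∉ x-y∉ _ _ _)
  where
  w r⁻¹ : ℕ → ℂ
  w = proj₁ (inverse-squares n x x∉)
  r⁻¹ = proj₁ (inverse-squares n (x - y) x-y∉)

  xw≈1 : ∀ j → j < n → (x + ↑ suc j) ^ 2 * w j ≈ 1#
  xw≈1 = proj₂ (inverse-squares n x x∉)

  x-yr≈1 : ∀ j → j < n → (x - y + ↑ suc j) ^ 2 * r⁻¹ j ≈ 1#
  x-yr≈1 = proj₂ (inverse-squares n (x - y) x-y∉)
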